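{- $$\liminf_{n\to\infty} r(S_n) = \liminf_{n\to\infty} r(N_n) = 0 \quad\text{and}\quad \limsup_{n\to\infty} r(S_n) = \limsup_{n\to\infty} r(N_n) = 1.$$
   Context: For a positive integer $n$, $\mathbb{Z}_n$ denotes the ring of integers modulo $n$. Define $S_n := \{ m \in \mathbb{Z}_n : m = x^2 + y^2 \text{ for some } x, y \in \mathbb{Z}_n\}$ (zero is allowed as one or both squares) and $N_n := \mathbb{Z}_n \setminus S_n$. For a subset $A \subseteq \mathbb{Z}_n$, its density is $r(A) := |A|/n$, where $|A|$ is the number of elements of $A$. The limits are taken over positive integers $n$. -}

module Defs where

open import Data.Nat using (ℕ; zero; suc; _*_; _≥_; NonZero)
open import Data.Nat.DivMod using (_%_)
open import Data.Fin using (Fin; toℕ)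
open import Data.Fin.Properties using (any?)
open import Data.List using (List; length; filter)
open import Data.List using () renaming (allFin to allFinL)
open import Data.Product using (∃; ∃-syntax; Σ-syntax; _×_; _,_)
open import Data.Integer using (+_)
open import Data.Rational.Unnormalised using (ℚᵘ; mkℚᵘ; _<_; _+_; _-_; 0ℚᵘ)
open import Relation.Binary.PropositionalEquality using (_≡_)
open import Relation.Nullary using (Dec; ¬_; ¬?)

import Data.Nat as ℕ

InS : (n : ℕ) .{{_ : NonZero n}} → Fin n → Set
InS n m = Σ[ x ∈ Fin n ] Σ[ y ∈ Fin n ] ((toℕ x * toℕ x ℕ.+ toℕ y * toℕ y) % n ≡ toℕ m)

InS? : (n : ℕ) .{{_ : NonZero n}} → (m : Fin n) → Dec (InS n m)
InS? n m = any? (λ x → any? (λ y →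
  ((toℕ x * toℕ x ℕ.+ toℕ y * toℕ y) % n) ℕ.≟ toℕ m))

cardS : (n : ℕ) .{{_ : NonZero n}} → ℕ
cardS n = length (filter (InS? n) (allFinL n))

cardN : (n : ℕ) .{{_ : NonZero n}} → ℕ
cardN n = length (filter (λ m → ¬? (InS? n m)) (allFinL n))

-- Densities as sequences indexed by k, standing for n = k + 1
-- (mkℚᵘ p d denotes p / (d+1)).
rS : ℕ → ℚᵘ
rS k = mkℚᵘ (+ cardS (suc k)) k

rN : ℕ → ℚᵘ
rN k = mkℚᵘ (+ cardN (suc k)) k

-- Standard ε-characterisation of liminf / limsup of a real sequence,
-- specialised to rational sequences and rational limits/ε.
IsLiminf : (ℕ → ℚᵘ) → ℚᵘ → Set
IsLiminf a L = ∀ (ε : ℚᵘ) → 0ℚᵘ < ε →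
  (∃[ N ] ∀ k → k ≥ N → L - ε < a k) ×
  (∀ N → ∃[ k ] (k ≥ N × a k < L + ε))

IsLimsup : (ℕ → ℚᵘ) → ℚᵘ → Set
IsLimsup a L = ∀ (ε : ℚᵘ) → 0ℚᵘ < ε →
  (∃[ N ] ∀ k → k ≥ N → a k < L + ε) ×
  (∀ N → ∃[ k ] (k ≥ N × L - ε < a k))

{-# OPTIONS --safe #-}
-- Modulo n = a² + 1 with a even, -1 is a square and 2 is invertible, so x² + y² = (x + a y)(x - a y)
-- represents every residue: r(S_n) = 1 for infinitely many n.
--
-- For r(S_n) → 0 let v range over the squarefree products of primes ≡ 3 (mod 4). A sum of two squares has
-- even valuation at each such prime, so the sets v S are pairwise disjoint, which bounds r(S_n) by
-- 1 / V with V = ∑ 1/v, up to a negligible error, for n a high power of a factorial. It remains to see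
-- that V diverges. Every odd number is u v w² with u a product of primes ≡ 1 (mod 4), so
-- ∑ 1/(2i+1) ≤ F V W with F = ∑ 1/u and W = ∑ 1/w² ≤ 2. Moreover F(x)² ≤ H(x²), H the harmonic sum: the
-- Dirichlet coefficients of F² are bounded by ∑_{d ∣ n} χ(d) ≥ 0, and the partial sums of ∑ χ(d)/d are at
-- most 1. Hence V(x)² ≥ c log² x / log x² is unbounded, without any estimate on primes.
module Submission where

open import Defs
open import Data.Empty using (⊥; ⊥-elim)
open import Data.Fin using (Fin; toℕ; fromℕ<)
open import Data.Fin.Properties using (all?; toℕ-fromℕ<; toℕ-injective; toℕ<n)
open import Data.List using ([]; _∷_; length; filter; tabulate; allFin)
open import Data.List.Properties using (filter-none; length-tabulate)
open import Data.List.Relation.Unary.All using (All; []; _∷_)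
open import Data.Nat using (ℕ; zero; suc; _+_; _*_; _^_; _∸_; _!; _/_; _%_; _≤_; _<_; z≤n; s≤s; _≟_; _≤?_; _<?_; NonZero; ≢-nonZero; ≢-nonZero⁻¹; >-nonZero; nonTrivial⇒n>1)
open import Data.Nat.Coprimality using (Coprime; coprime-/gcd; coprime-divisor)
open import Data.Nat.DivMod using (_mod_; m%n<n; m≡m%n+[m/n]*n; m/n*n≡m; [m+n]%n≡m%n; [m+kn]%n≡m%n; m<n⇒m%n≡m; m∣n⇒o%n%m≡o%m; %-distribˡ-+; %-distribˡ-*)
open import Data.Nat.Divisibility
open import Data.Nat.GCD using (gcd; gcd[m,n]∣m; gcd[m,n]∣n; gcd[m,n]≢0)
open import Data.Nat.Induction using (<-rec)
open import Data.Nat.ListAction using (product)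
open import Data.Nat.Primality using (Prime; prime?; prime[2]; ¬prime[1]; euclidsLemma; prime⇒irreducible; prime⇒nonZero; prime⇒nonTrivial)
open import Data.Nat.Primality.Factorisation using (factorise; module PrimeFactorisation)
open import Data.Nat.Tactic.RingSolver using (solve-∀)
open import Data.Product using (_×_; _,_; ∃-syntax; proj₁; proj₂)
open import Data.Rational using (ℚ; 0ℚ; 1ℚ; 1/_; Positive; nonNegative)
open import Data.Rational.Unnormalised using (ℚᵘ; mkℚᵘ; 0ℚᵘ; 1ℚᵘ; *<*; *≡*)
open import Data.Sum using (_⊎_; inj₁; inj₂)
open import Function using (_∘_)
open import Relation.Binary.PropositionalEquality using (_≡_; refl; sym; trans; cong; cong₂; subst; module ≡-Reasoning)
open import Relation.Nullary using (Dec; yes; no; ¬_; contradiction; _→-dec_; _⊎-dec_; _×-dec_; ¬?)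
open import Relation.Nullary.Decidable using (decidable-stable; map′; toWitness)
import Data.Integer as ℤ
import Data.Integer.Properties as ℤₚ
import Data.List.Relation.Unary.All as All
import Data.Nat.Coprimality as Coprimality
import Data.Nat.Properties as ℕₚ
import Data.Rational as ℚ
import Data.Rational.Properties as ℚₚ
import Data.Rational.Solver as ℚ
import Data.Rational.Unnormalised as ℚᵘ
import Data.Rational.Unnormalised.Properties as ℚᵘₚ
import Data.Rational.Unnormalised.Solver as ℚᵘ

open ℚ.+-*-Solver using (solve; _:=_; _:+_; _:*_; :-_; con)
module ℚᵘ-Solver = ℚᵘ.+-*-Solver
open ℚᵘ-Solver using () renaming (_:=_ to infix 4 _⊜_; _:+_ to infixl 6 _⊕_; :-_ to infix 8 ⊝_)

-- `F` is squared because each divisor `d` of a split number `n` has χ(d) = 1, so `n` has exactly ∑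
-- χ(d) divisors, `d` running over the divisors of `n`, and 1/n occurs in F² at most that often.
-- This makes `F` no larger than about the square root of the logarithm, while the sum of 1/(2i+1)
-- has the full logarithm; the other square root has to come from `V`.
--
-- The obstacle on the density side is that a congruence modulo `n` does not determine the valuation
-- of a sum of two squares. Its parity at `p` is forced only for residues not divisible by `p ^ k`,
-- where `p ^ k` divides `n`. Hence `n` is the power (x !) ^ k, and the residues divisible by some
-- `d ^ k` with 2 ≤ d < x are discarded. Their share is at most x / 2 ^ k, thus at most 1/x once x²
-- ≤ 2 ^ k; multiplied by V(x) ≤ x this costs one more `n` in the count.
--
-- Sums have finite ranges, and side conditions enter as indicators `𝟙`, so that every change of the
-- order of summation is an exchange of two independent ranges.

-- Rational sums

infix 4 _≤ℚ_
_≤ℚ_ : ℚ → ℚ → Set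
_≤ℚ_ = ℚ._≤_

*-monoˡ : ∀ {a b c} → 0ℚ ≤ℚ a → b ≤ℚ c → a ℚ.* b ≤ℚ a ℚ.* c
*-monoˡ {a} 0≤a = ℚₚ.*-monoˡ-≤-nonNeg a {{nonNegative 0≤a}}

*-monoʳ : ∀ {a b c} → 0ℚ ≤ℚ a → b ≤ℚ c → b ℚ.* a ≤ℚ c ℚ.* a
*-monoʳ {a} 0≤a = ℚₚ.*-monoʳ-≤-nonNeg a {{nonNegative 0≤a}}

*-mono : ∀ {a b c d} → 0ℚ ≤ℚ b → 0ℚ ≤ℚ c → a ≤ℚ b → c ≤ℚ d → a ℚ.* c ≤ℚ b ℚ.* d
*-mono 0≤b 0≤c a≤b c≤d = ℚₚ.≤-trans (*-monoʳ 0≤c a≤b) (*-monoˡ 0≤b c≤d)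

*-nonneg : ∀ {a b} → 0ℚ ≤ℚ a → 0ℚ ≤ℚ b → 0ℚ ≤ℚ a ℚ.* b
*-nonneg {a} {b} 0≤a 0≤b = ℚₚ.≤-trans (ℚₚ.≤-reflexive (sym (ℚₚ.*-zeroʳ a))) (*-monoˡ 0≤a 0≤b)

+-nonneg : ∀ {a b} → 0ℚ ≤ℚ a → 0ℚ ≤ℚ b → 0ℚ ≤ℚ a ℚ.+ b
+-nonneg 0≤a 0≤b = ℚₚ.+-mono-≤ 0≤a 0≤b

≤-+ʳ : ∀ {a b} → 0ℚ ≤ℚ b → a ≤ℚ a ℚ.+ b
≤-+ʳ {a} 0≤b = ℚₚ.≤-trans (ℚₚ.≤-reflexive (sym (ℚₚ.+-identityʳ a))) (ℚₚ.+-monoʳ-≤ a 0≤b)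

≤-+ˡ : ∀ {a b} → 0ℚ ≤ℚ a → b ≤ℚ a ℚ.+ b
≤-+ˡ {a} {b} 0≤a = ℚₚ.≤-trans (≤-+ʳ 0≤a) (ℚₚ.≤-reflexive (ℚₚ.+-comm b a))

0≤1 : 0ℚ ≤ℚ 1ℚ
0≤1 = ℚₚ.nonNegative⁻¹ 1ℚ

ι : ℕ → ℚ
ι zero    = 0ℚ
ι (suc n) = 1ℚ ℚ.+ ι n

ι-nonneg : ∀ n → 0ℚ ≤ℚ ι n
ι-nonneg zero    = ℚₚ.≤-refl
ι-nonneg (suc n) = +-nonneg 0≤1 (ι-nonneg n)

ι-+ : ∀ m n → ι (m + n) ≡ ι m ℚ.+ ι n
ι-+ zero    n = sym (ℚₚ.+-identityˡ (ι n))
ι-+ (suc m) n = trans (cong (1ℚ ℚ.+_) (ι-+ m n)) (sym (ℚₚ.+-assoc 1ℚ (ι m) (ι n)))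

ι-* : ∀ m n → ι (m * n) ≡ ι m ℚ.* ι n
ι-* zero    n = sym (ℚₚ.*-zeroˡ (ι n))
ι-* (suc m) n = trans (ι-+ n (m * n)) (trans (cong (ι n ℚ.+_) (ι-* m n))
  (solve 2 (λ a b → b :+ a :* b := (con 1ℚ :+ a) :* b) refl (ι m) (ι n)))

ι-mono : ∀ {m n} → m ≤ n → ι m ≤ℚ ι n
ι-mono {n = n} z≤n = ι-nonneg n
ι-mono (s≤s m≤n)   = ℚₚ.+-monoʳ-≤ 1ℚ (ι-mono m≤n)

ι-positive : ∀ n → Positive (ι (suc n))
ι-positive n = ℚₚ.pos+nonNeg⇒pos 1ℚ (ι n) {{nonNegative (ι-nonneg n)}}

ι-cancel-≤ : ∀ {m n} → ι m ≤ℚ ι n → m ≤ n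
ι-cancel-≤ {zero}          _ = z≤n
ι-cancel-≤ {suc m} {zero}  p = ⊥-elim (ℚₚ.<-irrefl refl (ℚₚ.<-≤-trans (ℚₚ.positive⁻¹ (ι (suc m)) {{ι-positive m}}) p))
ι-cancel-≤ {suc m} {suc n} p = s≤s (ι-cancel-≤ (cancel p))
  where
  cancel : ∀ {a b} → 1ℚ ℚ.+ a ≤ℚ 1ℚ ℚ.+ b → a ≤ℚ b
  cancel {a} {b} q = subst₂′ (ℚₚ.+-monoʳ-≤ (ℚ.- 1ℚ) q)
    where
    drop : ∀ x → ℚ.- 1ℚ ℚ.+ (1ℚ ℚ.+ x) ≡ x
    drop = solve 1 (λ x → :- con 1ℚ :+ (con 1ℚ :+ x) := x) refl
    subst₂′ : ℚ.- 1ℚ ℚ.+ (1ℚ ℚ.+ a) ≤ℚ ℚ.- 1ℚ ℚ.+ (1ℚ ℚ.+ b) → a ≤ℚ b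
    subst₂′ r = subst (_≤ℚ b) (drop a) (subst (ℚ.- 1ℚ ℚ.+ (1ℚ ℚ.+ a) ≤ℚ_) (drop b) r)

-- The junk value inv 0 = 0 lets sums of reciprocals start at index 0.
inv : ℕ → ℚ
inv zero    = 0ℚ
inv (suc n) = (1/ ι (suc n)) {{ℚₚ.pos⇒nonZero (ι (suc n)) {{ι-positive n}}}}

ι*inv : ∀ n → ι (suc n) ℚ.* inv (suc n) ≡ 1ℚ
ι*inv n = ℚₚ.*-inverseʳ (ι (suc n)) {{ℚₚ.pos⇒nonZero (ι (suc n)) {{ι-positive n}}}}

inv-nonneg : ∀ n → 0ℚ ≤ℚ inv n
inv-nonneg zero    = ℚₚ.≤-refl
inv-nonneg (suc n) = ℚₚ.<⇒≤ (ℚₚ.positive⁻¹ (inv (suc n)) {{ℚₚ.1/pos⇒pos (ι (suc n)) {{ι-positive n}}}})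

inv-unique : ∀ n x → ι (suc n) ℚ.* x ≡ 1ℚ → x ≡ inv (suc n)
inv-unique n x p = begin
  x                               ≡⟨ ℚₚ.*-identityˡ x ⟨
  1ℚ ℚ.* x                        ≡⟨ cong (ℚ._* x) (ι*inv n) ⟨
  ι (suc n) ℚ.* inv (suc n) ℚ.* x ≡⟨ solve 3 (λ a b c → a :* b :* c := b :* (a :* c)) refl (ι (suc n)) (inv (suc n)) x ⟩
  inv (suc n) ℚ.* (ι (suc n) ℚ.* x) ≡⟨ cong (inv (suc n) ℚ.*_) p ⟩
  inv (suc n) ℚ.* 1ℚ              ≡⟨ ℚₚ.*-identityʳ _ ⟩
  inv (suc n)                     ∎
  where open ≡-Reasoning

inv-* : ∀ m n → inv (m * n) ≡ inv m ℚ.* inv n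
inv-* zero    n       = sym (ℚₚ.*-zeroˡ (inv n))
inv-* (suc m) zero    = trans (cong inv (ℕₚ.*-zeroʳ m)) (sym (ℚₚ.*-zeroʳ (inv (suc m))))
inv-* (suc m) (suc n) = sym (inv-unique (n + m * suc n) _ (begin
  ι (suc m * suc n) ℚ.* (inv (suc m) ℚ.* inv (suc n))
    ≡⟨ cong (ℚ._* (inv (suc m) ℚ.* inv (suc n))) (ι-* (suc m) (suc n)) ⟩
  ι (suc m) ℚ.* ι (suc n) ℚ.* (inv (suc m) ℚ.* inv (suc n))
    ≡⟨ solve 4 (λ a b c d → a :* b :* (c :* d) := a :* c :* (b :* d)) refl (ι (suc m)) (ι (suc n)) (inv (suc m)) (inv (suc n)) ⟩
  ι (suc m) ℚ.* inv (suc m) ℚ.* (ι (suc n) ℚ.* inv (suc n))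
    ≡⟨ cong₂ ℚ._*_ (ι*inv m) (ι*inv n) ⟩
  1ℚ ∎))
  where open ≡-Reasoning

inv-antimono : ∀ {m n} → suc m ≤ n → inv n ≤ℚ inv (suc m)
inv-antimono {m} {suc n} m≤n = ℚₚ.*-cancelˡ-≤-pos (ι (suc m)) {{ι-positive m}} (begin
  ι (suc m) ℚ.* inv (suc n) ≤⟨ *-monoʳ (inv-nonneg (suc n)) (ι-mono m≤n) ⟩
  ι (suc n) ℚ.* inv (suc n) ≡⟨ trans (ι*inv n) (sym (ι*inv m)) ⟩
  ι (suc m) ℚ.* inv (suc m) ∎)
  where open ℚₚ.≤-Reasoning

𝟙 : ∀ {a} {A : Set a} → Dec A → ℚ
𝟙 (yes _) = 1ℚ
𝟙 (no _)  = 0ℚ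

𝟙-nonneg : ∀ {a} {A : Set a} (d : Dec A) → 0ℚ ≤ℚ 𝟙 d
𝟙-nonneg (yes _) = 0≤1
𝟙-nonneg (no _)  = ℚₚ.≤-refl

𝟙-yes : ∀ {a} {A : Set a} (d : Dec A) → A → 𝟙 d ≡ 1ℚ
𝟙-yes (yes _) _ = refl
𝟙-yes (no ¬a) a = contradiction a ¬a

𝟙-no : ∀ {a} {A : Set a} (d : Dec A) → ¬ A → 𝟙 d ≡ 0ℚ
𝟙-no (yes a) ¬a = contradiction a ¬a
𝟙-no (no _)  _  = refl

𝟙-mono : ∀ {a b} {A : Set a} {B : Set b} (d : Dec A) (e : Dec B) → (A → B) → 𝟙 d ≤ℚ 𝟙 e
𝟙-mono (yes a) e f = ℚₚ.≤-reflexive (sym (𝟙-yes e (f a)))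
𝟙-mono (no _)  e f = 𝟙-nonneg e

𝟙-cong : ∀ {a b} {A : Set a} {B : Set b} (d : Dec A) (e : Dec B) → (A → B) → (B → A) → 𝟙 d ≡ 𝟙 e
𝟙-cong d e f g = ℚₚ.≤-antisym (𝟙-mono d e f) (𝟙-mono e d g)

∑ : ℕ → (ℕ → ℚ) → ℚ
∑ zero    f = 0ℚ
∑ (suc n) f = ∑ n f ℚ.+ f n

∑-cong : ∀ n {f g} → (∀ i → i < n → f i ≡ g i) → ∑ n f ≡ ∑ n g
∑-cong zero    p = refl
∑-cong (suc n) p = cong₂ ℚ._+_ (∑-cong n (λ i i<n → p i (ℕₚ.m<n⇒m<1+n i<n))) (p n ℕₚ.≤-refl)

∑-mono : ∀ n {f g} → (∀ i → i < n → f i ≤ℚ g i) → ∑ n f ≤ℚ ∑ n g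
∑-mono zero    p = ℚₚ.≤-refl
∑-mono (suc n) p = ℚₚ.+-mono-≤ (∑-mono n (λ i i<n → p i (ℕₚ.m<n⇒m<1+n i<n))) (p n ℕₚ.≤-refl)

∑-const : ∀ n c → ∑ n (λ _ → c) ≡ ι n ℚ.* c
∑-const zero    c = sym (ℚₚ.*-zeroˡ c)
∑-const (suc n) c = trans (cong (ℚ._+ c) (∑-const n c))
  (solve 2 (λ a b → a :* b :+ b := (con 1ℚ :+ a) :* b) refl (ι n) c)

∑-zero : ∀ n {f} → (∀ i → i < n → f i ≡ 0ℚ) → ∑ n f ≡ 0ℚ
∑-zero n p = trans (∑-cong n p) (trans (∑-const n 0ℚ) (ℚₚ.*-zeroʳ (ι n)))

∑-nonneg : ∀ n {f} → (∀ i → i < n → 0ℚ ≤ℚ f i) → 0ℚ ≤ℚ ∑ n f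
∑-nonneg n p = ℚₚ.≤-trans (ℚₚ.≤-reflexive (sym (∑-zero n (λ _ _ → refl)))) (∑-mono n p)

∑-+ : ∀ n f g → ∑ n (λ i → f i ℚ.+ g i) ≡ ∑ n f ℚ.+ ∑ n g
∑-+ zero    f g = refl
∑-+ (suc n) f g = trans (cong (ℚ._+ (f n ℚ.+ g n)) (∑-+ n f g))
  (solve 4 (λ a b c d → a :+ b :+ (c :+ d) := a :+ c :+ (b :+ d)) refl (∑ n f) (∑ n g) (f n) (g n))

∑-*ˡ : ∀ n c f → ∑ n (λ i → c ℚ.* f i) ≡ c ℚ.* ∑ n f
∑-*ˡ zero    c f = sym (ℚₚ.*-zeroʳ c)
∑-*ˡ (suc n) c f = trans (cong (ℚ._+ c ℚ.* f n) (∑-*ˡ n c f)) (sym (ℚₚ.*-distribˡ-+ c (∑ n f) (f n)))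

∑-*ʳ : ∀ n c f → ∑ n (λ i → f i ℚ.* c) ≡ ∑ n f ℚ.* c
∑-*ʳ n c f = trans (∑-cong n (λ i _ → ℚₚ.*-comm (f i) c)) (trans (∑-*ˡ n c f) (ℚₚ.*-comm c (∑ n f)))

∑-swap : ∀ m n (f : ℕ → ℕ → ℚ) → ∑ m (λ i → ∑ n (λ j → f i j)) ≡ ∑ n (λ j → ∑ m (λ i → f i j))
∑-swap zero    n f = sym (∑-zero n (λ _ _ → refl))
∑-swap (suc m) n f = trans (cong (ℚ._+ ∑ n (f m)) (∑-swap m n f)) (sym (∑-+ n (λ j → ∑ m (λ i → f i j)) (f m)))

∑-split : ∀ m n f → ∑ (n + m) f ≡ ∑ m f ℚ.+ ∑ n (λ i → f (i + m))
∑-split m zero    f = sym (ℚₚ.+-identityʳ (∑ m f))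
∑-split m (suc n) f = trans (cong (ℚ._+ f (n + m)) (∑-split m n f)) (ℚₚ.+-assoc (∑ m f) _ _)

∑-extend : ∀ {m n f} → m ≤ n → (∀ i → 0ℚ ≤ℚ f i) → ∑ m f ≤ℚ ∑ n f
∑-extend {m} {n} {f} m≤n 0≤f = subst (λ k → ∑ m f ≤ℚ ∑ k f) (ℕₚ.m∸n+n≡m m≤n)
  (ℚₚ.≤-trans (≤-+ʳ (∑-nonneg (n ∸ m) (λ i _ → 0≤f (i + m))))
    (ℚₚ.≤-reflexive (sym (∑-split m (n ∸ m) f))))

term≤∑ : ∀ {n f} k → k < n → (∀ i → 0ℚ ≤ℚ f i) → f k ≤ℚ ∑ n f
term≤∑ {n} {f} k k<n 0≤f = ℚₚ.≤-trans (≤-+ˡ (∑-nonneg k (λ i _ → 0≤f i))) (∑-extend k<n 0≤f)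

∑-trunc : ∀ {m n} → m ≤ n → ∀ f → (∀ i → m ≤ i → f i ≡ 0ℚ) → ∑ n f ≡ ∑ m f
∑-trunc {m} {n} m≤n f p = trans (cong (λ k → ∑ k f) (sym (ℕₚ.m∸n+n≡m m≤n)))
  (trans (∑-split m (n ∸ m) f) (trans
    (cong (∑ m f ℚ.+_) (∑-zero (n ∸ m) (λ i _ → p (i + m) (ℕₚ.m≤n+m m i))))
    (ℚₚ.+-identityʳ (∑ m f))))

∑-single : ∀ {n f} k → k < n → (∀ i → ¬ i ≡ k → f i ≡ 0ℚ) → ∑ n f ≡ f k
∑-single {n} {f} k k<n p = trans
  (∑-trunc k<n f (λ i k<i → p i (λ i≡k → ℕₚ.<-irrefl (sym i≡k) k<i)))
  (trans (cong (ℚ._+ f k) (∑-zero k (λ i i<k → p i (λ i≡k → ℕₚ.<-irrefl i≡k i<k))))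
    (ℚₚ.+-identityˡ (f k)))

∑-exclusive≤1 : ∀ {a} n {A : ℕ → Set a} (d : ∀ i → Dec (A i)) → (∀ {i j} → A i → A j → i ≡ j) → ∑ n (λ i → 𝟙 (d i)) ≤ℚ 1ℚ
∑-exclusive≤1 zero    d excl = 0≤1
∑-exclusive≤1 (suc n) d excl with d n
... | no _   = ℚₚ.≤-trans (ℚₚ.≤-reflexive (ℚₚ.+-identityʳ _)) (∑-exclusive≤1 n d excl)
... | yes an = ℚₚ.≤-reflexive (cong (ℚ._+ 1ℚ)
  (∑-zero n (λ i i<n → 𝟙-no (d i) (λ ai → ℕₚ.<-irrefl (excl ai an) i<n))))

-- Divisors of sums of two squares

prime-∣-prime : ∀ {p q} → Prime p → Prime q → p ∣ q → p ≡ q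
prime-∣-prime pp pq p∣q with prime⇒irreducible pq p∣q
... | inj₁ refl = ⊥-elim (¬prime[1] pp)
... | inj₂ p≡q  = p≡q

gcd-split : ∀ a b → ¬ a ≡ 0 → ∃[ g ] ∃[ a′ ] ∃[ b′ ] (a ≡ a′ * g × b ≡ b′ * g × Coprime a′ b′ × NonZero g)
gcd-split a b a≢0 = g , a / g , b / g , sym (m/n*n≡m (gcd[m,n]∣m a b)) , sym (m/n*n≡m (gcd[m,n]∣n a b)) , coprime-/gcd a b , g≢0
  where
  g = gcd a b
  instance
    g≢0 : NonZero g
    g≢0 = ≢-nonZero (gcd[m,n]≢0 a b (inj₁ a≢0))

*-%4 : ∀ a b {r s} → a % 4 ≡ r → b % 4 ≡ s → (a * b) % 4 ≡ (r * s) % 4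
*-%4 a b refl refl = %-distribˡ-* a b 4

even-%4 : ∀ n → (n % 4) % 2 ≡ 0 → 2 ∣ n
even-%4 n p = m%n≡0⇒n∣m n 2 (trans (sym (m∣n⇒o%n%m≡o%m 2 4 n (divides 2 refl))) p)

odd-%4 : ∀ n → (n % 4) % 2 ≡ 1 → ¬ 2 ∣ n
odd-%4 n p 2∣n with trans (sym (n∣m⇒m%n≡0 n 2 2∣n)) (trans (sym (m∣n⇒o%n%m≡o%m 2 4 n (divides 2 refl))) p)
... | ()

2-prime≡2 : ∀ {p} → Prime p → 2 ∣ p → p ≡ 2
2-prime≡2 pp 2∣p = sym (prime-∣-prime (toWitness {a? = prime? 2} _) pp 2∣p)

data Residue (p : ℕ) : Set where
  two   : p ≡ 2 → Residue p
  one   : p % 4 ≡ 1 → Residue p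
  three : p % 4 ≡ 3 → Residue p

prime-residue : ∀ {p} → Prime p → Residue p
prime-residue {p} pp with p % 4 in eq | m%n<n p 4
... | 0 | _ = two (2-prime≡2 pp (even-%4 p (cong (_% 2) eq)))
... | 1 | _ = one eq
... | 2 | _ = two (2-prime≡2 pp (even-%4 p (cong (_% 2) eq)))
... | 3 | _ = three eq
... | suc (suc (suc (suc _))) | s≤s (s≤s (s≤s (s≤s ())))

-- Residues 1 modulo 4 are closed under products, so not every prime factor can have residue 1.
factor-not1 : ∀ n → .{{NonZero n}} → ¬ n % 4 ≡ 1 → ∃[ p ] (Prime p × p ∣ n × ¬ p % 4 ≡ 1)
factor-not1 n n%4≢1 = go factors factorsPrime (λ e → n%4≢1 (trans (cong (_% 4) isFactorisation) e)) (∣-reflexive (sym isFactorisation))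
  where
  open PrimeFactorisation (factorise n)
  go : ∀ ps → All Prime ps → ¬ product ps % 4 ≡ 1 → product ps ∣ n → ∃[ p ] (Prime p × p ∣ n × ¬ p % 4 ≡ 1)
  go []       _          h _ = ⊥-elim (h refl)
  go (p ∷ ps) (pp ∷ pps) h d with p % 4 ≟ 1
  ... | no  p≢1 = p , pp , m*n∣⇒m∣ p (product ps) d , p≢1
  ... | yes p≡1 = go ps pps (λ e → h (*-%4 p (product ps) p≡1 e)) (m*n∣⇒n∣ p (product ps) d)

factor-3mod4 : ∀ n → n % 4 ≡ 3 → ∃[ p ] (Prime p × p ∣ n × p % 4 ≡ 3)
factor-3mod4 zero    ()
factor-3mod4 n@(suc _) n%4≡3 with factor-not1 n (λ e → 1≢3 (trans (sym e) n%4≡3))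
  where
  1≢3 : ¬ 1 ≡ 3
  1≢3 ()
... | p , pp , p∣n , p≢1 with prime-residue pp
... | two refl = ⊥-elim (odd-%4 n (cong (_% 2) n%4≡3) p∣n)
... | one e    = ⊥-elim (p≢1 e)
... | three e  = p , pp , p∣n , e

-- If `a` and `b` are not both even, the sum of their squares is 1 modulo 4 or 2 modulo 8; dividing
-- by `q` ≡ 3 modulo 4 turns this into 3 modulo 4 or 6 modulo 8. Passing through the residue of the
-- sum gives two checks of 64 pairs in place of one over all quadruples.
cofactor-mod8 : ∀ a b q e → a * a + b * b ≡ q * e → ¬ (2 ∣ a × 2 ∣ b) → q % 4 ≡ 3 → e % 4 ≡ 3 ⊎ e % 8 ≡ 6
cofactor-mod8 a b q e eq ¬even q3 = subst (λ x → x ≡ 3 ⊎ e % 8 ≡ 6) (m∣n⇒o%n%m≡o%m 4 8 e (divides 2 refl))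
  (subst (λ z → (z % 4 ≡ 3) ⊎ (z ≡ 6)) (r≡ e)
  (table (r a) (r b) (r q) (r e)
    (λ (x , y) → ¬even (m%n≡0⇒n∣m a 2 (trans (low 2 a 4 refl) x) , m%n≡0⇒n∣m b 2 (trans (low 2 b 4 refl) y)))
    (trans (sym (low 4 q 2 refl)) q3)
    (begin
      (toℕ (r a) * toℕ (r a) + toℕ (r b) * toℕ (r b)) % 8
        ≡⟨ cong₂ (λ x y → (x * x + y * y) % 8) (r≡ a) (r≡ b) ⟩
      (a % 8 * (a % 8) + b % 8 * (b % 8)) % 8
        ≡⟨ %-distribˡ-+ (a % 8 * (a % 8)) (b % 8 * (b % 8)) 8 ⟩
      ((a % 8 * (a % 8)) % 8 + (b % 8 * (b % 8)) % 8) % 8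
        ≡⟨ cong₂ (λ x y → (x + y) % 8) (%-distribˡ-* a a 8) (%-distribˡ-* b b 8) ⟨
      ((a * a) % 8 + (b * b) % 8) % 8
        ≡⟨ %-distribˡ-+ (a * a) (b * b) 8 ⟨
      (a * a + b * b) % 8
        ≡⟨ cong (_% 8) eq ⟩
      (q * e) % 8
        ≡⟨ %-distribˡ-* q e 8 ⟩
      (q % 8 * (e % 8)) % 8
        ≡⟨ cong₂ (λ x y → (x * y) % 8) (r≡ q) (r≡ e) ⟨
      (toℕ (r q) * toℕ (r e)) % 8 ∎)))
  where
  open ≡-Reasoning
  r : ℕ → Fin 8
  r n = fromℕ< (m%n<n n 8)
  r≡ : ∀ n → toℕ (r n) ≡ n % 8
  r≡ n = toℕ-fromℕ< (m%n<n n 8)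
  low : ∀ m n k .{{_ : NonZero m}} → 8 ≡ k * m → n % m ≡ toℕ (r n) % m
  low m n k p = trans (sym (m∣n⇒o%n%m≡o%m m 8 n (divides k p))) (cong (_% m) (sym (r≡ n)))
  table₁ : ∀ (x y : Fin 8) → ¬ (toℕ x % 2 ≡ 0 × toℕ y % 2 ≡ 0) → (toℕ x * toℕ x + toℕ y * toℕ y) % 8 % 4 ≡ 1 ⊎ (toℕ x * toℕ x + toℕ y * toℕ y) % 8 ≡ 2
  table₁ = toWitness {a? = all? λ x → all? λ y →
    ¬? (toℕ x % 2 ≟ 0 ×-dec toℕ y % 2 ≟ 0) →-dec
      ((toℕ x * toℕ x + toℕ y * toℕ y) % 8 % 4 ≟ 1 ⊎-dec (toℕ x * toℕ x + toℕ y * toℕ y) % 8 ≟ 2)} _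
  table₂ : ∀ (z w : Fin 8) → toℕ z % 4 ≡ 3 → (toℕ z * toℕ w) % 8 % 4 ≡ 1 ⊎ (toℕ z * toℕ w) % 8 ≡ 2 → toℕ w % 4 ≡ 3 ⊎ toℕ w ≡ 6
  table₂ = toWitness {a? = all? λ z → all? λ w → toℕ z % 4 ≟ 3 →-dec
    (((toℕ z * toℕ w) % 8 % 4 ≟ 1 ⊎-dec (toℕ z * toℕ w) % 8 ≟ 2) →-dec (toℕ w % 4 ≟ 3 ⊎-dec toℕ w ≟ 6))} _
  table : ∀ (x y z w : Fin 8) → ¬ (toℕ x % 2 ≡ 0 × toℕ y % 2 ≡ 0) → toℕ z % 4 ≡ 3 →
          (toℕ x * toℕ x + toℕ y * toℕ y) % 8 ≡ (toℕ z * toℕ w) % 8 → toℕ w % 4 ≡ 3 ⊎ toℕ w ≡ 6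
  table x y z w odd z3 eq = table₂ z w z3 (subst (λ s → s % 4 ≡ 1 ⊎ s ≡ 2) eq (table₁ x y odd))

cofactor-prime : ∀ e → e % 4 ≡ 3 ⊎ e % 8 ≡ 6 → ∃[ p ] (Prime p × p ∣ e × p % 4 ≡ 3)
cofactor-prime e (inj₁ e3) = factor-3mod4 e e3
-- Here `e` is twice the number 3 + 4 (e / 8), which is 3 modulo 4.
cofactor-prime e (inj₂ e6) with factor-3mod4 (3 + (e / 8) * 4) ([m+kn]%n≡m%n 3 (e / 8) 4)
... | p , pp , p∣h , p3 = p , pp , ∣-trans p∣h (divides 2 (begin
    e                       ≡⟨ m≡m%n+[m/n]*n e 8 ⟩
    e % 8 + (e / 8) * 8     ≡⟨ cong (_+ (e / 8) * 8) e6 ⟩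
    6 + (e / 8) * 8         ≡⟨ double (e / 8) ⟩
    2 * (3 + (e / 8) * 4)   ∎)) , p3
  where
  open ≡-Reasoning
  double : ∀ k → 6 + k * 8 ≡ 2 * (3 + k * 4)
  double = solve-∀

-- `a₀` is the absolute value of the least absolute residue: `a % q` or `q ∸ a % q`. Its square
-- agrees with that of `a` modulo `q`; the free summand `c` allows the two coordinates of a sum of
-- squares to be reduced one after the other.
least-residue : ∀ q a → .{{_ : NonZero q}} → ∃[ a₀ ] (2 * a₀ ≤ q × (q ∣ a₀ → q ∣ a) × (∀ c → q ∣ a * a + c → q ∣ a₀ * a₀ + c))
least-residue q a with 2 * (a % q) ≤? q
... | yes 2r≤q = a % q , 2r≤q , (λ d → subst (q ∣_) (sym (m≡m%n+[m/n]*n a q)) (∣m∣n⇒∣m+n d (n∣m*n (a / q)))) , λ c d →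
  ∣m+n∣m⇒∣n (subst (q ∣_) (expand (a % q) (a / q) q c) (subst (λ x → q ∣ x * x + c) (m≡m%n+[m/n]*n a q) d)) (m∣m*n _)
  where
  expand : ∀ r k q c → (r + k * q) * (r + k * q) + c ≡ q * (k * (r + r + k * q)) + (r * r + c)
  expand = solve-∀
... | no 2r≰q = a₀ , 2a₀≤q , (λ d → ∣m+n∣m⇒∣n (subst (q ∣_) (ℕₚ.+-comm a a₀) q∣a+a₀) d) , λ c d →
  ∣m+n∣m⇒∣n (subst (q ∣_) (swap a a₀ c) (∣m∣n⇒∣m+n d (∣m⇒∣m*n a₀ q∣a+a₀))) (∣m⇒∣m*n a q∣a+a₀)
  where
  r = a % q
  a₀ = q ∸ r
  a₀+r≡q : a₀ + r ≡ q
  a₀+r≡q = ℕₚ.m∸n+n≡m (ℕₚ.<⇒≤ (m%n<n a q))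
  2a₀≤q : 2 * a₀ ≤ q
  2a₀≤q = ℕₚ.+-cancelʳ-≤ (2 * r) (2 * a₀) q (begin
    2 * a₀ + 2 * r ≡⟨ ℕₚ.*-distribˡ-+ 2 a₀ r ⟨
    2 * (a₀ + r)   ≡⟨ cong (2 *_) a₀+r≡q ⟩
    2 * q          ≡⟨ cong (q +_) (ℕₚ.+-identityʳ q) ⟩
    q + q          ≤⟨ ℕₚ.+-monoʳ-≤ q (ℕₚ.<⇒≤ (ℕₚ.≰⇒> 2r≰q)) ⟩
    q + 2 * r      ∎)
    where open ℕₚ.≤-Reasoning
  q∣a+a₀ : q ∣ a + a₀
  q∣a+a₀ = divides (suc (a / q)) (begin
    a + a₀                  ≡⟨ cong (_+ a₀) (m≡m%n+[m/n]*n a q) ⟩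
    r + (a / q) * q + a₀    ≡⟨ rot r (a / q * q) a₀ ⟩
    a₀ + r + (a / q) * q    ≡⟨ cong (_+ (a / q) * q) a₀+r≡q ⟩
    suc (a / q) * q         ∎)
    where
    open ≡-Reasoning
    rot : ∀ x y z → x + y + z ≡ z + x + y
    rot = solve-∀
  swap : ∀ a b c → a * a + c + (a + b) * b ≡ (a + b) * a + (b * b + c)
  swap = solve-∀

-- Descent: a prime q ≡ 3 (mod 4) dividing a sum of two coprime squares below (q/2)² leaves a cofactor
-- smaller than q, and by residues modulo 8 that cofactor has again a prime factor ≡ 3 (mod 4).
sum-of-squares-divisor : ∀ q → Prime q → q % 4 ≡ 3 → ∀ a b → q ∣ a * a + b * b → q ∣ a
sum-of-squares-divisor = <-rec _ step
  where
  step : ∀ q → (∀ {p} → p < q → Prime p → p % 4 ≡ 3 → ∀ a b → p ∣ a * a + b * b → p ∣ a) →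
         Prime q → q % 4 ≡ 3 → ∀ a b → q ∣ a * a + b * b → q ∣ a
  step q ih pq q3 a b q∣a²+b² with q ∣? a
  ... | yes q∣a = q∣a
  ... | no  q∤a = ⊥-elim (absurd (least-residue q a) (least-residue q b))
    where
    instance _ = prime⇒nonZero pq
    absurd : ∃[ a₀ ] (2 * a₀ ≤ q × (q ∣ a₀ → q ∣ a) × (∀ c → q ∣ a * a + c → q ∣ a₀ * a₀ + c)) →
             ∃[ b₀ ] (2 * b₀ ≤ q × (q ∣ b₀ → q ∣ b) × (∀ c → q ∣ b * b + c → q ∣ b₀ * b₀ + c)) → ⊥
    absurd (a₀ , 2a₀≤q , q∣a₀⇒ , ra) (b₀ , 2b₀≤q , _ , rb) with gcd-split a₀ b₀ (λ { refl → q∤a (q∣a₀⇒ (q ∣0)) })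
    ... | g , a₁ , b₁ , refl , refl , coprime , g≢0 = conclude (euclidsLemma (g * g) (a₁ * a₁ + b₁ * b₁) pq (subst (q ∣_) (factor a₁ b₁ g) q∣a₀²+b₀²))
      where
      instance _ = g≢0
      q∣a₀²+b₀² : q ∣ a₁ * g * (a₁ * g) + b₁ * g * (b₁ * g)
      q∣a₀²+b₀² = subst (q ∣_) (ℕₚ.+-comm (b₁ * g * (b₁ * g)) _)
        (rb (a₁ * g * (a₁ * g)) (subst (q ∣_) (ℕₚ.+-comm (a₁ * g * (a₁ * g)) (b * b)) (ra (b * b) q∣a²+b²)))
      factor : ∀ a b g → a * g * (a * g) + b * g * (b * g) ≡ g * g * (a * a + b * b)
      factor = solve-∀
      q∣g⇒⊥ : ¬ q ∣ g
      q∣g⇒⊥ q∣g = q∤a (q∣a₀⇒ (∣n⇒∣m*n a₁ q∣g))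
      bound : ∀ x → 2 * (x * g) ≤ q → 2 * x ≤ q
      bound x p = ℕₚ.≤-trans (ℕₚ.*-monoʳ-≤ 2 (ℕₚ.m≤m*n x g)) p
      conclude : q ∣ g * g ⊎ q ∣ a₁ * a₁ + b₁ * b₁ → ⊥
      conclude (inj₁ d) with euclidsLemma g g pq d
      ... | inj₁ q∣g = q∣g⇒⊥ q∣g
      ... | inj₂ q∣g = q∣g⇒⊥ q∣g
      conclude (inj₂ (divides e eq)) with cofactor-prime e (cofactor-mod8 a₁ b₁ q e (trans eq (ℕₚ.*-comm e q))
        (λ (x , y) → contradiction (coprime (x , y)) λ ()) q3)
      -- The induction hypothesis for `p`, applied in both orders, makes `p` a common divisor of the
      -- coprime numbers `a₁` and `b₁`.
      ... | p , pp , p∣e , p3 = ¬prime[1] (subst Prime (coprime (ih p<q pp p3 a₁ b₁ p∣s ,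
              ih p<q pp p3 b₁ a₁ (subst (p ∣_) (ℕₚ.+-comm (a₁ * a₁) (b₁ * b₁)) p∣s))) pp)
        where
        p∣s : p ∣ a₁ * a₁ + b₁ * b₁
        p∣s = subst (p ∣_) (sym eq) (∣m⇒∣m*n q p∣e)
        2e≤q : 2 * e ≤ q
        2e≤q = ℕₚ.*-cancelˡ-≤ (2 * q) (begin
          2 * q * (2 * e)                            ≡⟨ four q e ⟩
          4 * (e * q)                                ≡⟨ cong (4 *_) eq ⟨
          4 * (a₁ * a₁ + b₁ * b₁)                    ≡⟨ squares a₁ b₁ ⟩
          2 * a₁ * (2 * a₁) + 2 * b₁ * (2 * b₁)      ≤⟨ ℕₚ.+-mono-≤ (ℕₚ.*-mono-≤ (bound a₁ 2a₀≤q) (bound a₁ 2a₀≤q)) (ℕₚ.*-mono-≤ (bound b₁ 2b₀≤q) (bound b₁ 2b₀≤q)) ⟩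
          q * q + q * q                              ≡⟨ dbl q ⟩
          2 * q * q                                  ∎)
          where
          open ℕₚ.≤-Reasoning
          instance _ = ℕₚ.m*n≢0 2 q
          four : ∀ q e → 2 * q * (2 * e) ≡ 4 * (e * q)
          four = solve-∀
          squares : ∀ a b → 4 * (a * a + b * b) ≡ 2 * a * (2 * a) + 2 * b * (2 * b)
          squares = solve-∀
          dbl : ∀ q → q * q + q * q ≡ 2 * q * q
          dbl = solve-∀
        e≢0 : ¬ e ≡ 0
        e≢0 refl = q∤a (q∣a₀⇒ (subst (λ x → q ∣ x * g) (sym (sq0 a₁ (ℕₚ.m+n≡0⇒m≡0 (a₁ * a₁) eq))) (q ∣0)))
          where
          sq0 : ∀ x → x * x ≡ 0 → x ≡ 0
          sq0 zero _ = refl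
        p<q : p < q
        p<q = begin-strict
          p      ≤⟨ ∣⇒≤ {{≢-nonZero e≢0}} p∣e ⟩
          e      <⟨ ℕₚ.m<m+n e (ℕₚ.n≢0⇒n>0 e≢0) ⟩
          e + e  ≡⟨ cong (e +_) (ℕₚ.+-identityʳ e) ⟨
          2 * e  ≤⟨ 2e≤q ⟩
          q      ∎
          where open ℕₚ.≤-Reasoning

-- Split and inert numbers

-- These are the products of primes ≡ 1 modulo 4. Quantifying over all divisors makes the character
-- equal to 1 on every term of the divisor sum, and excludes 0.
Split : ℕ → Set
Split u = ∀ {d} → d ∣ u → d % 4 ≡ 1

Inert : ℕ → Set
Inert v = ∀ {p} → Prime p → p ∣ v → p % 4 ≡ 3 × ¬ p * p ∣ v

split? : ∀ u → Dec (Split u)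
split? zero    = no λ s → contradiction (s (0 ∣0)) λ ()
split? u@(suc _) = map′ (λ f {d} d∣u → f {d} (s≤s (∣⇒≤ d∣u)) d∣u) (λ s {d} _ → s {d})
  (ℕₚ.allUpTo? (λ d → d ∣? u →-dec d % 4 ≟ 1) (suc u))

inert? : ∀ v → Dec (Inert v)
inert? zero    = no λ s → contradiction (proj₁ (s prime[2] (2 ∣0))) λ ()
inert? v@(suc _) = map′ (λ f {p} pp p∣v → f {p} (s≤s (∣⇒≤ p∣v)) pp p∣v) (λ s {p} _ → s {p})
  (ℕₚ.allUpTo? (λ p → prime? p →-dec (p ∣? v →-dec (p % 4 ≟ 3 ×-dec ¬? (p * p ∣? v)))) (suc v))

split≢0 : ∀ {u} → Split u → ¬ u ≡ 0
split≢0 s refl = contradiction (s (0 ∣0)) λ ()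

inert≢0 : ∀ {v} → Inert v → ¬ v ≡ 0
inert≢0 s refl = contradiction (proj₁ (s prime[2] (2 ∣0))) λ ()

split-1 : Split 1
split-1 d∣1 = cong (_% 4) (∣1⇒≡1 d∣1)

split-prime : ∀ {p} → Prime p → p % 4 ≡ 1 → Split p
split-prime pp p1 d∣p with prime⇒irreducible pp d∣p
... | inj₁ refl = refl
... | inj₂ refl = p1

-- A divisor of the product is the gcd with `u`, a divisor of `u`, times a cofactor that divides
-- `u′`; both are 1 modulo 4.
split-* : ∀ {u u′} → Split u → Split u′ → Split (u * u′)
split-* {u} {u′} su su′ {d} d∣uu′ with gcd-split u d (split≢0 su)
... | g , u₁ , d₁ , refl , refl , coprime , g≢0 = *-%4 d₁ g (su′ d₁∣u′) (su (n∣m*n u₁))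
  where
  instance _ = g≢0
  comm : ∀ a b c → a * b * c ≡ a * c * b
  comm = solve-∀
  d₁∣u′ : d₁ ∣ u′
  d₁∣u′ = coprime-divisor (Coprimality.sym coprime) (*-cancelʳ-∣ g (subst (d₁ * g ∣_) (comm u₁ g u′) d∣uu′))

¬split⇒prime : ∀ n .{{_ : NonZero n}} → ¬ Split n → ∃[ p ] (Prime p × p ∣ n × ¬ p % 4 ≡ 1)
¬split⇒prime n ¬s with ℕₚ.anyUpTo? (λ d → d ∣? n ×-dec ¬? (d % 4 ≟ 1)) (suc n)
... | no none = ⊥-elim (¬s λ {d} d∣n → decidable-stable (d % 4 ≟ 1) λ h → none (d , s≤s (∣⇒≤ d∣n) , d∣n , h))
... | yes (zero , _ , 0∣n , _) = ⊥-elim (≢-nonZero⁻¹ n (0∣⇒≡0 0∣n))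
... | yes (suc d , _ , d∣n , d≢1) with factor-not1 (suc d) d≢1
... | p , pp , p∣d , p≢1 = p , pp , ∣-trans p∣d d∣n , p≢1

inert-1 : Inert 1
inert-1 pp p∣1 = ⊥-elim (¬prime[1] (subst Prime (∣1⇒≡1 p∣1) pp))

inert-∣ : ∀ {v v′} → v′ ∣ v → Inert v → Inert v′
inert-∣ v′∣v iv pp p∣v′ with iv pp (∣-trans p∣v′ v′∣v)
... | p3 , p²∤v = p3 , λ p²∣v′ → p²∤v (∣-trans p²∣v′ v′∣v)

inert-* : ∀ {p v} → Prime p → p % 4 ≡ 3 → ¬ p ∣ v → Inert v → Inert (p * v)
inert-* {p} {v} pp p3 p∤v iv {q} pq q∣pv with euclidsLemma p v pq q∣pv
... | inj₁ q∣p with prime-∣-prime pq pp q∣p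
...   | refl = p3 , λ p²∣pv → p∤v (*-cancelˡ-∣ p {{prime⇒nonZero pp}} p²∣pv)
inert-* {p} {v} pp p3 p∤v iv {q} pq q∣pv | inj₂ q∣v@(divides v′ refl) with iv pq q∣v
...   | q3 , q²∤v = q3 , λ q²∣pv → case (euclidsLemma p v′ pq (*-cancelʳ-∣ q {{prime⇒nonZero pq}} (subst (q * q ∣_) (sym (ℕₚ.*-assoc p v′ q)) q²∣pv)))
  where
  case : q ∣ p ⊎ q ∣ v′ → ⊥
  case (inj₁ q∣p)  = p∤v (subst (_∣ v′ * q) (prime-∣-prime pq pp q∣p) q∣v)
  case (inj₂ q∣v′) = q²∤v (*-monoˡ-∣ q q∣v′)

record Decomposition (n : ℕ) : Set where
  field
    u v w   : ℕ
    eq      : n ≡ u * v * (w * w)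
    split   : Split u
    inert   : Inert v

-- The prime factors are inserted one at a time. A prime ≡ 1 goes into `u`. A prime ≡ 3 goes into
-- `v` if it is new there; otherwise it meets its copy in `v`, and the pair moves into `w`, which
-- keeps `v` squarefree.
decompose : ∀ n → ¬ 2 ∣ n → Decomposition n
decompose zero      odd = ⊥-elim (odd (2 ∣0))
decompose n@(suc _) odd = subst Decomposition (sym isFactorisation)
    (go factors factorsPrime (λ 2∣ → odd (subst (2 ∣_) (sym isFactorisation) 2∣)))
  where
  open PrimeFactorisation (factorise n)
  into-u : ∀ p u v w → p * (u * v * (w * w)) ≡ p * u * v * (w * w)
  into-u = solve-∀
  into-v : ∀ p u v w → p * (u * v * (w * w)) ≡ u * (p * v) * (w * w)
  into-v = solve-∀
  into-w : ∀ p u v w → p * (u * (v * p) * (w * w)) ≡ u * v * (p * w * (p * w))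
  into-w = solve-∀
  go : ∀ ps → All Prime ps → ¬ 2 ∣ product ps → Decomposition (product ps)
  go []       _          _   = record { u = 1 ; v = 1 ; w = 1 ; eq = refl ; split = split-1 ; inert = inert-1 }
  go (p ∷ ps) (pp ∷ pps) odd with go ps pps (λ 2∣ → odd (∣n⇒∣m*n p 2∣)) | prime-residue pp
  ... | _ | two refl = ⊥-elim (odd (m∣m*n (product ps)))
  ... | record { u = u ; v = v ; w = w ; eq = e ; split = su ; inert = iv } | one p1 = record
    { u = p * u ; v = v ; w = w ; eq = trans (cong (p *_) e) (into-u p u v w)
    ; split = split-* (split-prime pp p1) su ; inert = iv }
  ... | record { u = u ; v = v ; w = w ; eq = e ; split = su ; inert = iv } | three p3 with p ∣? v
  ...   | no p∤v = record
    { u = u ; v = p * v ; w = w ; eq = trans (cong (p *_) e) (into-v p u v w)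
    ; split = su ; inert = inert-* pp p3 p∤v iv }
  ...   | yes (divides v′ refl) = record
    { u = u ; v = v′ ; w = p * w ; eq = trans (cong (p *_) e) (into-w p u v′ w)
    ; split = su ; inert = inert-∣ (m∣m*n p) iv }

-- The character modulo 4

-- The substitution n = d m, obtained by inserting the indicator of d m = n and exchanging the sums.
-- The cutoff on `m` is kept as an indicator, so the range does not depend on `d`.
∑-multiples : ∀ d X (g : ℕ → ℚ) → .{{_ : NonZero d}} →
  ∑ X (λ n → 𝟙 (d ∣? n) ℚ.* g n) ≡ ∑ X (λ m → 𝟙 (d * m <? X) ℚ.* g (d * m))
∑-multiples d X g = begin
  ∑ X (λ n → 𝟙 (d ∣? n) ℚ.* g n)                     ≡⟨ ∑-cong X by-quotient ⟩
  ∑ X (λ n → ∑ X (λ m → 𝟙 (d * m ≟ n) ℚ.* g n))     ≡⟨ ∑-swap X X _ ⟩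
  ∑ X (λ m → ∑ X (λ n → 𝟙 (d * m ≟ n) ℚ.* g n))     ≡⟨ ∑-cong X by-multiple ⟩
  ∑ X (λ m → 𝟙 (d * m <? X) ℚ.* g (d * m))           ∎
  where
  open ≡-Reasoning
  zero-term : ∀ {A : Set} (a? : Dec A) x → ¬ A → 𝟙 a? ℚ.* x ≡ 0ℚ
  zero-term a? x ¬a = trans (cong (ℚ._* x) (𝟙-no a? ¬a)) (ℚₚ.*-zeroˡ x)
  by-quotient : ∀ n → n < X → 𝟙 (d ∣? n) ℚ.* g n ≡ ∑ X (λ m → 𝟙 (d * m ≟ n) ℚ.* g n)
  by-quotient n n<X with d ∣? n
  ... | yes (divides q refl) = sym (trans
    (∑-single q (ℕₚ.≤-<-trans (ℕₚ.m≤m*n q d) n<X)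
      (λ m m≢q → zero-term (d * m ≟ q * d) (g (q * d)) λ e → m≢q (ℕₚ.*-cancelˡ-≡ m q d (trans e (ℕₚ.*-comm q d)))))
    (cong (ℚ._* g (q * d)) (𝟙-yes (d * q ≟ q * d) (ℕₚ.*-comm d q))))
  ... | no d∤n = trans (ℚₚ.*-zeroˡ (g n)) (sym (∑-zero X λ m _ → zero-term (d * m ≟ n) (g n)
    λ e → d∤n (divides m (trans (sym e) (ℕₚ.*-comm d m)))))
  by-multiple : ∀ m → m < X → ∑ X (λ n → 𝟙 (d * m ≟ n) ℚ.* g n) ≡ 𝟙 (d * m <? X) ℚ.* g (d * m)
  by-multiple m _ with d * m <? X
  ... | yes dm<X = trans (∑-single (d * m) dm<X (λ n n≢ → zero-term (d * m ≟ n) (g n) λ e → n≢ (sym e)))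
    (cong (ℚ._* g (d * m)) (𝟙-yes (d * m ≟ d * m) refl))
  ... | no dm≮X = trans (∑-zero X (λ n n<X → zero-term (d * m ≟ n) (g n) λ { refl → dm≮X n<X }))
    (sym (ℚₚ.*-zeroˡ (g (d * m))))

χ₄ : ℕ → ℚ
χ₄ 1 = 1ℚ
χ₄ 3 = ℚ.- 1ℚ
χ₄ _ = 0ℚ

χ : ℕ → ℚ
χ n = χ₄ (n % 4)

χ-3* : ∀ p → p % 4 ≡ 3 → ∀ m → χ (p * m) ≡ ℚ.- χ m
χ-3* p p3 m with m % 4 in eq | m%n<n m 4
... | 0 | _ = cong χ₄ (*-%4 p m p3 eq)
... | 1 | _ = cong χ₄ (*-%4 p m p3 eq)
... | 2 | _ = cong χ₄ (*-%4 p m p3 eq)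
... | 3 | _ = cong χ₄ (*-%4 p m p3 eq)
... | suc (suc (suc (suc _))) | s≤s (s≤s (s≤s (s≤s ())))

χ-even : ∀ d → 2 ∣ d → χ d ≡ 0ℚ
χ-even d 2∣d with d % 4 in eq
... | 0 = refl
... | 1 = ⊥-elim (odd-%4 d (cong (_% 2) eq) 2∣d)
... | 2 = refl
... | 3 = ⊥-elim (odd-%4 d (cong (_% 2) eq) 2∣d)
... | suc (suc (suc (suc _))) = refl

∣p*k⇒∣k : ∀ {p d k} → Prime p → ¬ p ∣ d → d ∣ p * k → d ∣ k
∣p*k⇒∣k {p} {d} {k} pp p∤d (divides q e) with euclidsLemma q d pp (divides k (trans (sym e) (ℕₚ.*-comm p k)))
... | inj₂ p∣d = ⊥-elim (p∤d p∣d)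
... | inj₁ (divides q′ refl) = divides q′ (ℕₚ.*-cancelˡ-≡ k (q′ * d) p {{prime⇒nonZero pp}}
  (trans e (trans (cong (_* d) (ℕₚ.*-comm q′ p)) (ℕₚ.*-assoc p q′ d))))

∑-neg : ∀ n f → ∑ n (λ i → ℚ.- f i) ≡ ℚ.- ∑ n f
∑-neg zero    f = refl
∑-neg (suc n) f = trans (cong (ℚ._+ ℚ.- f n) (∑-neg n f)) (sym (ℚₚ.neg-distrib-+ (∑ n f) (f n)))

module Divisors (X : ℕ) where

  -- For 0 < n < X the range contains every divisor of `n`, and this is the full divisor sum of the
  -- character, classically a quarter of the number of representations of `n` as a sum of two
  -- squares.
  R : ℕ → ℚ
  R n = ∑ X (λ d → 𝟙 (d ∣? n) ℚ.* χ d)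

  multiple-part : ℕ → ℕ → ℚ
  multiple-part p n = ∑ X (λ d → 𝟙 (p ∣? d) ℚ.* (𝟙 (d ∣? n) ℚ.* χ d))

  coprime-part : ℕ → ℕ → ℚ
  coprime-part p n = ∑ X (λ d → (1ℚ ℚ.- 𝟙 (p ∣? d)) ℚ.* (𝟙 (d ∣? n) ℚ.* χ d))

  R-parts : ∀ p n → R n ≡ multiple-part p n ℚ.+ coprime-part p n
  R-parts p n = trans
    (∑-cong X (λ d _ → solve 2 (λ a b → b := a :* b :+ (con 1ℚ :+ :- a) :* b) refl (𝟙 (p ∣? d)) (𝟙 (d ∣? n) ℚ.* χ d)))
    (∑-+ X _ _)

  coprime-part-* : ∀ {p} → Prime p → ∀ k → coprime-part p (p * k) ≡ coprime-part p k
  coprime-part-* {p} pp k = ∑-cong X λ d _ → term d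
    where
    term : ∀ d → (1ℚ ℚ.- 𝟙 (p ∣? d)) ℚ.* (𝟙 (d ∣? p * k) ℚ.* χ d) ≡ (1ℚ ℚ.- 𝟙 (p ∣? d)) ℚ.* (𝟙 (d ∣? k) ℚ.* χ d)
    term d with p ∣? d
    ... | yes _   = trans (ℚₚ.*-zeroˡ (𝟙 (d ∣? p * k) ℚ.* χ d)) (sym (ℚₚ.*-zeroˡ (𝟙 (d ∣? k) ℚ.* χ d)))
    ... | no  p∤d = cong (λ x → (1ℚ ℚ.- 0ℚ) ℚ.* (x ℚ.* χ d))
      (𝟙-cong (d ∣? p * k) (d ∣? k) (∣p*k⇒∣k pp p∤d) (∣n⇒∣m*n p))

  -- Substitute d = p m: the condition becomes m ∣ k and the character changes sign. The bound on
  -- `p * k` ensures that no such `d` is cut off.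
  multiple-part-* : ∀ {p} → Prime p → p % 4 ≡ 3 → ∀ k → .{{_ : NonZero k}} → p * k < X → multiple-part p (p * k) ≡ ℚ.- R k
  multiple-part-* {p} pp p3 k pk<X = trans (∑-multiples p X (λ d → 𝟙 (d ∣? p * k) ℚ.* χ d))
    (trans (∑-cong X (λ m _ → term m)) (∑-neg X _))
    where
    instance _ = prime⇒nonZero pp
    term : ∀ m → 𝟙 (p * m <? X) ℚ.* (𝟙 (p * m ∣? p * k) ℚ.* χ (p * m)) ≡ ℚ.- (𝟙 (m ∣? k) ℚ.* χ m)
    term m with m ∣? k
    ... | yes m∣k = begin
      𝟙 (p * m <? X) ℚ.* (𝟙 (p * m ∣? p * k) ℚ.* χ (p * m))
        ≡⟨ cong₂ (λ x y → x ℚ.* (y ℚ.* χ (p * m)))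
             (𝟙-yes (p * m <? X) (ℕₚ.≤-<-trans (ℕₚ.*-monoʳ-≤ p (∣⇒≤ m∣k)) pk<X))
             (𝟙-yes (p * m ∣? p * k) (*-monoʳ-∣ p m∣k)) ⟩
      1ℚ ℚ.* (1ℚ ℚ.* χ (p * m))
        ≡⟨ cong (λ x → 1ℚ ℚ.* (1ℚ ℚ.* x)) (χ-3* p p3 m) ⟩
      1ℚ ℚ.* (1ℚ ℚ.* ℚ.- χ m)
        ≡⟨ solve 1 (λ x → con 1ℚ :* (con 1ℚ :* :- x) := :- (con 1ℚ :* x)) refl (χ m) ⟩
      ℚ.- (1ℚ ℚ.* χ m) ∎
      where open ≡-Reasoning
    ... | no m∤k = begin
      𝟙 (p * m <? X) ℚ.* (𝟙 (p * m ∣? p * k) ℚ.* χ (p * m))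
        ≡⟨ cong (λ y → 𝟙 (p * m <? X) ℚ.* (y ℚ.* χ (p * m))) (𝟙-no (p * m ∣? p * k) (λ d → m∤k (*-cancelˡ-∣ p d))) ⟩
      𝟙 (p * m <? X) ℚ.* (0ℚ ℚ.* χ (p * m))
        ≡⟨ solve 3 (λ a b c → a :* (con 0ℚ :* b) := :- (con 0ℚ :* c)) refl (𝟙 (p * m <? X)) (χ (p * m)) (χ m) ⟩
      ℚ.- (0ℚ ℚ.* χ m) ∎
      where open ≡-Reasoning

  -- With the new factor `p`, the divisors that are multiples of `p` contribute minus `R k`, and the
  -- other divisors are those of `k`; their contribution cancels against the same part of `R k`.
  R-3* : ∀ {p} → Prime p → p % 4 ≡ 3 → ∀ k → .{{_ : NonZero k}} → p * k < X → R (p * k) ≡ ℚ.- multiple-part p k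
  R-3* {p} pp p3 k pk<X = begin
    R (p * k)                                             ≡⟨ R-parts p (p * k) ⟩
    multiple-part p (p * k) ℚ.+ coprime-part p (p * k)   ≡⟨ cong₂ ℚ._+_ (multiple-part-* pp p3 k pk<X) (coprime-part-* pp k) ⟩
    ℚ.- R k ℚ.+ coprime-part p k                          ≡⟨ cong (λ x → ℚ.- x ℚ.+ coprime-part p k) (R-parts p k) ⟩
    ℚ.- (multiple-part p k ℚ.+ coprime-part p k) ℚ.+ coprime-part p k
      ≡⟨ solve 2 (λ a b → :- (a :+ b) :+ b := :- a) refl (multiple-part p k) (coprime-part p k) ⟩
    ℚ.- multiple-part p k                                 ∎
    where open ≡-Reasoning

  R-3*-coprime : ∀ {p} → Prime p → p % 4 ≡ 3 → ∀ k → .{{_ : NonZero k}} → p * k < X → ¬ p ∣ k → R (p * k) ≡ 0ℚ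
  R-3*-coprime {p} pp p3 k pk<X p∤k = trans (R-3* pp p3 k pk<X) (cong ℚ.-_ (∑-zero X λ d _ → term d))
    where
    term : ∀ d → 𝟙 (p ∣? d) ℚ.* (𝟙 (d ∣? k) ℚ.* χ d) ≡ 0ℚ
    term d with p ∣? d | d ∣? k
    ... | yes p∣d | yes d∣k = ⊥-elim (p∤k (∣-trans p∣d d∣k))
    ... | yes _   | no  _   = trans (ℚₚ.*-identityˡ _) (ℚₚ.*-zeroˡ (χ d))
    ... | no  _   | d∣?k    = ℚₚ.*-zeroˡ (𝟙 d∣?k ℚ.* χ d)

  R-3*3* : ∀ {p} → Prime p → p % 4 ≡ 3 → ∀ k → .{{_ : NonZero k}} → p * (p * k) < X → R (p * (p * k)) ≡ R k
  R-3*3* {p} pp p3 k ppk<X = trans (R-3* pp p3 (p * k) ppk<X) (trans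
    (cong ℚ.-_ (multiple-part-* pp p3 k (ℕₚ.≤-<-trans (ℕₚ.m≤n*m (p * k) p) ppk<X)))
    (solve 1 (λ x → :- (:- x) := x) refl (R k)))
    where
    instance
      _ = prime⇒nonZero pp
      _ = ℕₚ.m*n≢0 p k

  -- Even divisors have character 0, and the odd divisors of 2k are those of `k`.
  R-2* : ∀ k → R (2 * k) ≡ R k
  R-2* k = ∑-cong X λ d _ → term d
    where
    term : ∀ d → 𝟙 (d ∣? 2 * k) ℚ.* χ d ≡ 𝟙 (d ∣? k) ℚ.* χ d
    term d with 2 ∣? d
    ... | yes 2∣d = trans (cong (𝟙 (d ∣? 2 * k) ℚ.*_) (χ-even d 2∣d))
      (trans (ℚₚ.*-zeroʳ (𝟙 (d ∣? 2 * k))) (sym (trans (cong (𝟙 (d ∣? k) ℚ.*_) (χ-even d 2∣d)) (ℚₚ.*-zeroʳ (𝟙 (d ∣? k))))))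
    ... | no 2∤d = cong (ℚ._* χ d) (𝟙-cong (d ∣? 2 * k) (d ∣? k) (∣p*k⇒∣k prime[2] 2∤d) (∣n⇒∣m*n 2))

  R-split : ∀ {n} → Split n → ∀ d → 𝟙 (d ∣? n) ℚ.* χ d ≡ 𝟙 (d ∣? n)
  R-split {n} s d with d ∣? n
  ... | yes d∣n = trans (ℚₚ.*-identityˡ (χ d)) (cong χ₄ (s d∣n))
  ... | no _    = ℚₚ.*-zeroˡ (χ d)

  -- For a split number every term is nonnegative. Otherwise some prime not ≡ 1 can be stripped: the
  -- prime 2 leaves the sum unchanged, and a prime ≡ 3 either divides `n` exactly once, when the sum
  -- vanishes, or is stripped as a square, when the sum is again unchanged.
  R-nonneg : ∀ n → .{{NonZero n}} → n < X → 0ℚ ≤ℚ R n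
  R-nonneg = <-rec _ step
    where
    step : ∀ n → (∀ {m} → m < n → .{{NonZero m}} → m < X → 0ℚ ≤ℚ R m) → .{{NonZero n}} → n < X → 0ℚ ≤ℚ R n
    step n ih {{n≢0}} n<X with split? n
    ... | yes s = ∑-nonneg X λ d _ → ℚₚ.≤-trans (𝟙-nonneg (d ∣? n)) (ℚₚ.≤-reflexive (sym (R-split s d)))
    ... | no ¬s with ¬split⇒prime n ¬s
    ... | p , pp , divides k refl , p≢1 = subst (λ m → 0ℚ ≤ℚ R m) (ℕₚ.*-comm p k) (go (prime-residue pp))
      where
      instance
        k≢0 : NonZero k
        k≢0 = ℕₚ.m*n≢0⇒m≢0 k {p}
        _ = prime⇒nonTrivial pp
        _ = prime⇒nonZero pp
      pk<X : p * k < X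
      pk<X = subst (_< X) (ℕₚ.*-comm k p) n<X
      k<n : k < k * p
      k<n = ℕₚ.m<m*n k p (nonTrivial⇒n>1 p)
      go : Residue p → 0ℚ ≤ℚ R (p * k)
      go (one p1)   = ⊥-elim (p≢1 p1)
      go (two refl) = ℚₚ.≤-trans (ih k<n (ℕₚ.<-trans k<n n<X)) (ℚₚ.≤-reflexive (sym (R-2* k)))
      go (three p3) with p ∣? k
      ... | no p∤k = ℚₚ.≤-reflexive (sym (R-3*-coprime pp p3 k pk<X p∤k))
      ... | yes (divides l refl) = subst (λ m → 0ℚ ≤ℚ R (p * m)) (ℕₚ.*-comm p l)
          (ℚₚ.≤-trans (ih l<n (ℕₚ.<-trans l<n n<X)) (ℚₚ.≤-reflexive (sym (R-3*3* pp p3 l (subst (λ m → p * m < X) (ℕₚ.*-comm l p) pk<X)))))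
        where
        instance
          l≢0 : NonZero l
          l≢0 = ℕₚ.m*n≢0⇒m≢0 l {p}
        l<n : l < l * p * p
        l<n = ℕₚ.<-trans (ℕₚ.m<m*n l p (nonTrivial⇒n>1 p)) k<n

≤-move : ∀ {a b c} → a ≤ℚ c ℚ.- b → a ℚ.+ b ≤ℚ c
≤-move {a} {b} {c} p = ℚₚ.≤-trans (ℚₚ.+-monoˡ-≤ b p) (ℚₚ.≤-reflexive (solve 2 (λ c b → c :+ :- b :+ b := c) refl c b))

χ-inv : ℕ → ℚ
χ-inv d = χ d ℚ.* inv d

χ-inv-value : ∀ s j {x} → χ₄ (s % 4) ≡ x → χ-inv (s + j * 4) ≡ x ℚ.* inv (s + j * 4)
χ-inv-value s j e = cong (ℚ._* inv (s + j * 4)) (trans (cong χ₄ ([m+kn]%n≡m%n s j 4)) e)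

χ-inv-even : ∀ s j → χ₄ (s % 4) ≡ 0ℚ → χ-inv (s + j * 4) ≡ 0ℚ
χ-inv-even s j e = trans (χ-inv-value s j e) (ℚₚ.*-zeroˡ (inv (s + j * 4)))

-- The alternating series 1 - 1/3 + 1/5 - ... is largest just after a positive term. The sharper
-- bound at index 4j leaves exactly the room for the next term 1/(4j+1), and subtracting 1/(4j+3)
-- restores the room for 1/(4j+5).
χ-prefix₂ : ∀ j → ∑ (2 + j * 4) χ-inv ≤ℚ 1ℚ
χ-prefix₀ : ∀ j → ∑ (j * 4) χ-inv ≤ℚ 1ℚ ℚ.- inv (1 + j * 4)

χ-prefix₀ zero    = ℚₚ.≤-reflexive refl
χ-prefix₀ (suc j) = begin
  ∑ (2 + j * 4) χ-inv ℚ.+ χ-inv (2 + j * 4) ℚ.+ χ-inv (3 + j * 4)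
    ≡⟨ cong₂ (λ x y → ∑ (2 + j * 4) χ-inv ℚ.+ x ℚ.+ y) (χ-inv-even 2 j refl) (χ-inv-value 3 j refl) ⟩
  ∑ (2 + j * 4) χ-inv ℚ.+ 0ℚ ℚ.+ ℚ.- 1ℚ ℚ.* inv (3 + j * 4)
    ≡⟨ solve 2 (λ a b → a :+ con 0ℚ :+ :- con 1ℚ :* b := a :+ :- b) refl (∑ (2 + j * 4) χ-inv) (inv (3 + j * 4)) ⟩
  ∑ (2 + j * 4) χ-inv ℚ.- inv (3 + j * 4)
    ≤⟨ ℚₚ.+-mono-≤ (χ-prefix₂ j) (ℚₚ.neg-antimono-≤ (inv-antimono (s≤s (s≤s (s≤s (ℕₚ.m≤n+m (j * 4) 2)))))) ⟩
  1ℚ ℚ.- inv (1 + suc j * 4) ∎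
  where open ℚₚ.≤-Reasoning

χ-prefix₂ j = begin
  ∑ (j * 4) χ-inv ℚ.+ χ-inv (j * 4) ℚ.+ χ-inv (1 + j * 4)
    ≡⟨ cong₂ (λ x y → ∑ (j * 4) χ-inv ℚ.+ x ℚ.+ y) (χ-inv-even 0 j refl) (χ-inv-value 1 j refl) ⟩
  ∑ (j * 4) χ-inv ℚ.+ 0ℚ ℚ.+ 1ℚ ℚ.* inv (1 + j * 4)
    ≡⟨ solve 2 (λ a b → a :+ con 0ℚ :+ con 1ℚ :* b := a :+ b) refl (∑ (j * 4) χ-inv) (inv (1 + j * 4)) ⟩
  ∑ (j * 4) χ-inv ℚ.+ inv (1 + j * 4)
    ≤⟨ ≤-move (χ-prefix₀ j) ⟩
  1ℚ ∎
  where open ℚₚ.≤-Reasoning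

χ-prefix : ∀ Y → ∑ Y χ-inv ≤ℚ 1ℚ
χ-prefix Y = subst (λ y → ∑ y χ-inv ≤ℚ 1ℚ) (sym (m≡m%n+[m/n]*n Y 4)) (go (Y % 4) (m%n<n Y 4))
  where
  j = Y / 4
  prefix₀ : ∑ (j * 4) χ-inv ≤ℚ 1ℚ
  prefix₀ = ℚₚ.≤-trans (≤-+ʳ (inv-nonneg (1 + j * 4))) (≤-move (χ-prefix₀ j))
  skip : ∀ {a b} → a ≤ℚ 1ℚ → b ≡ 0ℚ → a ℚ.+ b ≤ℚ 1ℚ
  skip {a} p refl = ℚₚ.≤-trans (ℚₚ.≤-reflexive (ℚₚ.+-identityʳ a)) p
  go : ∀ s → s < 4 → ∑ (s + j * 4) χ-inv ≤ℚ 1ℚ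
  go 0 _ = prefix₀
  go 1 _ = skip prefix₀ (χ-inv-even 0 j refl)
  go 2 _ = χ-prefix₂ j
  go 3 _ = skip (χ-prefix₂ j) (χ-inv-even 2 j refl)
  go (suc (suc (suc (suc _)))) (s≤s (s≤s (s≤s (s≤s ()))))

-- `g` may change sign, so terms cannot simply be dropped; but the indicator of a downward closed
-- set only shortens the sum to a prefix, which the uniform bound covers.
∑-downset≤ : ∀ {A : ℕ → Set} (a? : ∀ i → Dec (A i)) → (∀ {i j} → i ≤ j → A j → A i) →
  ∀ {g c} → (∀ n → ∑ n g ≤ℚ c) → ∀ n → ∑ n (λ i → 𝟙 (a? i) ℚ.* g i) ≤ℚ c
∑-downset≤ a? down bound zero    = bound 0
∑-downset≤ a? down {g} bound (suc n) with a? n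
... | yes an = ℚₚ.≤-trans (ℚₚ.≤-reflexive (cong₂ ℚ._+_
    (∑-cong n λ i i<n → trans (cong (ℚ._* g i) (𝟙-yes (a? i) (down (ℕₚ.<⇒≤ i<n) an))) (ℚₚ.*-identityˡ (g i)))
    (ℚₚ.*-identityˡ (g n)))) (bound (suc n))
... | no _ = ℚₚ.≤-trans (ℚₚ.≤-reflexive (trans (cong (∑ n (λ i → 𝟙 (a? i) ℚ.* g i) ℚ.+_) (ℚₚ.*-zeroˡ (g n))) (ℚₚ.+-identityʳ _)))
  (∑-downset≤ a? down bound n)

-- Reciprocal sums over split and inert numbers

split-weight : ℕ → ℚ
split-weight u = 𝟙 (split? u) ℚ.* inv u

split-weight-nonneg : ∀ u → 0ℚ ≤ℚ split-weight u
split-weight-nonneg u = *-nonneg (𝟙-nonneg (split? u)) (inv-nonneg u)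

inert-weight : ℕ → ℚ
inert-weight v = 𝟙 (inert? v) ℚ.* inv v

inert-weight-nonneg : ∀ v → 0ℚ ≤ℚ inert-weight v
inert-weight-nonneg v = *-nonneg (𝟙-nonneg (inert? v)) (inv-nonneg v)

H F V W : ℕ → ℚ
H x = ∑ x inv
F x = ∑ x split-weight
V x = ∑ x inert-weight
W x = ∑ x (λ w → inv (w * w))

split-weight-* : ∀ a b → split-weight a ℚ.* split-weight b ≤ℚ split-weight (a * b)
split-weight-* a b = begin
  𝟙 (split? a) ℚ.* inv a ℚ.* (𝟙 (split? b) ℚ.* inv b)
    ≡⟨ solve 4 (λ p q r s → p :* q :* (r :* s) := p :* r :* (q :* s)) refl (𝟙 (split? a)) (inv a) (𝟙 (split? b)) (inv b) ⟩
  𝟙 (split? a) ℚ.* 𝟙 (split? b) ℚ.* (inv a ℚ.* inv b)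
    ≡⟨ cong (𝟙 (split? a) ℚ.* 𝟙 (split? b) ℚ.*_) (inv-* a b) ⟨
  𝟙 (split? a) ℚ.* 𝟙 (split? b) ℚ.* inv (a * b)
    ≤⟨ *-monoʳ (inv-nonneg (a * b)) indicator ⟩
  𝟙 (split? (a * b)) ℚ.* inv (a * b) ∎
  where
  open ℚₚ.≤-Reasoning
  indicator : 𝟙 (split? a) ℚ.* 𝟙 (split? b) ≤ℚ 𝟙 (split? (a * b))
  indicator with split? a | split? b
  ... | yes sa | yes sb = ℚₚ.≤-reflexive (sym (𝟙-yes (split? (a * b)) (split-* {a} {b} sa sb)))
  ... | yes _  | no _   = 𝟙-nonneg (split? (a * b))
  ... | no _   | sb?    = ℚₚ.≤-trans (ℚₚ.≤-reflexive (ℚₚ.*-zeroˡ (𝟙 sb?))) (𝟙-nonneg (split? (a * b)))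

F²≤H : ∀ x → F x ℚ.* F x ≤ℚ H (x * x)
F²≤H x = begin
  F x ℚ.* F x
    ≡⟨ ∑-*ʳ x (F x) split-weight ⟨
  ∑ x (λ a → split-weight a ℚ.* F x)
    ≤⟨ ∑-mono x (λ a a<x → row a a<x) ⟩
  ∑ x (λ a → ∑ X (λ n → 𝟙 (a ∣? n) ℚ.* split-weight n))
    ≤⟨ ∑-extend x≤X (λ a → ∑-nonneg X (λ n _ → *-nonneg (𝟙-nonneg (a ∣? n)) (split-weight-nonneg n))) ⟩
  ∑ X (λ a → ∑ X (λ n → 𝟙 (a ∣? n) ℚ.* split-weight n))
    ≡⟨ ∑-swap X X _ ⟩
  ∑ X (λ n → ∑ X (λ a → 𝟙 (a ∣? n) ℚ.* split-weight n))
    ≤⟨ ∑-mono X dominated ⟩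
  ∑ X (λ n → ∑ X (λ a → 𝟙 (a ∣? n) ℚ.* χ a ℚ.* inv n))
    ≡⟨ ∑-swap X X _ ⟩
  ∑ X (λ a → ∑ X (λ n → 𝟙 (a ∣? n) ℚ.* χ a ℚ.* inv n))
    ≡⟨ ∑-cong X (λ a _ → reindex a) ⟩
  ∑ X (λ a → ∑ X (λ m → inv m ℚ.* (𝟙 (a * m <? X) ℚ.* χ-inv a)))
    ≡⟨ ∑-swap X X _ ⟩
  ∑ X (λ m → ∑ X (λ a → inv m ℚ.* (𝟙 (a * m <? X) ℚ.* χ-inv a)))
    ≤⟨ ∑-mono X (λ m _ → column m) ⟩
  ∑ X inv ∎
  where
  open ℚₚ.≤-Reasoning
  X = x * x
  open Divisors X
  x≤X : x ≤ X
  x≤X = square x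
    where
    square : ∀ x → x ≤ x * x
    square zero    = z≤n
    square (suc x) = ℕₚ.m≤m*n (suc x) (suc x)
  -- Each pair (a, b) is recorded at the multiple n = a b of `a`, which lies below `X` = x².
  row : ∀ a → a < x → split-weight a ℚ.* F x ≤ℚ ∑ X (λ n → 𝟙 (a ∣? n) ℚ.* split-weight n)
  row zero a<x = ℚₚ.≤-trans (ℚₚ.≤-reflexive (ℚₚ.*-zeroˡ (F x)))
    (∑-nonneg X (λ n _ → *-nonneg (𝟙-nonneg (0 ∣? n)) (split-weight-nonneg n)))
  row a@(suc _) a<x = begin
    split-weight a ℚ.* F x
      ≡⟨ ∑-*ˡ x (split-weight a) split-weight ⟨
    ∑ x (λ b → split-weight a ℚ.* split-weight b)
      ≤⟨ ∑-mono x (λ b b<x → ℚₚ.≤-trans (split-weight-* a b) (ℚₚ.≤-reflexive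
           (sym (trans (cong (ℚ._* split-weight (a * b)) (𝟙-yes (a * b <? X) (ℕₚ.*-mono-< a<x b<x))) (ℚₚ.*-identityˡ _))))) ⟩
    ∑ x (λ b → 𝟙 (a * b <? X) ℚ.* split-weight (a * b))
      ≤⟨ ∑-extend x≤X (λ b → *-nonneg (𝟙-nonneg (a * b <? X)) (split-weight-nonneg (a * b))) ⟩
    ∑ X (λ b → 𝟙 (a * b <? X) ℚ.* split-weight (a * b))
      ≡⟨ ∑-multiples a X split-weight ⟨
    ∑ X (λ n → 𝟙 (a ∣? n) ℚ.* split-weight n) ∎
  -- For split `n` the two sides agree term by term; for other `n` > 0 the left side vanishes and
  -- the right side is `R n` / n ≥ 0. At n = 0 the value `inv 0` = 0 makes both vanish.
  dominated : ∀ n → n < X → ∑ X (λ a → 𝟙 (a ∣? n) ℚ.* split-weight n) ≤ℚ ∑ X (λ a → 𝟙 (a ∣? n) ℚ.* χ a ℚ.* inv n)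
  dominated zero _ = ∑-mono X λ a _ → ℚₚ.≤-reflexive
    (trans (ℚₚ.*-zeroʳ (𝟙 (a ∣? 0))) (sym (ℚₚ.*-zeroʳ (𝟙 (a ∣? 0) ℚ.* χ a))))
  dominated n@(suc _) n<X with split? n
  ... | yes s = ∑-mono X λ a _ → ℚₚ.≤-reflexive
    (cong₂ ℚ._*_ (sym (R-split {n} s a)) (ℚₚ.*-identityˡ (inv n)))
  ... | no _  = begin
    ∑ X (λ a → 𝟙 (a ∣? n) ℚ.* (0ℚ ℚ.* inv n))
      ≡⟨ ∑-zero X (λ a _ → trans (cong (𝟙 (a ∣? n) ℚ.*_) (ℚₚ.*-zeroˡ (inv n))) (ℚₚ.*-zeroʳ (𝟙 (a ∣? n)))) ⟩
    0ℚ
      ≤⟨ *-nonneg (R-nonneg n n<X) (inv-nonneg n) ⟩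
    R n ℚ.* inv n
      ≡⟨ ∑-*ʳ X (inv n) (λ a → 𝟙 (a ∣? n) ℚ.* χ a) ⟨
    ∑ X (λ a → 𝟙 (a ∣? n) ℚ.* χ a ℚ.* inv n) ∎
  reindex : ∀ a → ∑ X (λ n → 𝟙 (a ∣? n) ℚ.* χ a ℚ.* inv n) ≡ ∑ X (λ m → inv m ℚ.* (𝟙 (a * m <? X) ℚ.* χ-inv a))
  reindex zero = trans
    (∑-zero X λ n _ → trans (cong (ℚ._* inv n) (ℚₚ.*-zeroʳ (𝟙 (0 ∣? n)))) (ℚₚ.*-zeroˡ (inv n)))
    (sym (∑-zero X λ m _ → trans (cong (inv m ℚ.*_) (ℚₚ.*-zeroʳ (𝟙 (0 <? X)))) (ℚₚ.*-zeroʳ (inv m))))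
  reindex a@(suc _) = begin-equality
    ∑ X (λ n → 𝟙 (a ∣? n) ℚ.* χ a ℚ.* inv n)
      ≡⟨ ∑-cong X (λ n _ → ℚₚ.*-assoc (𝟙 (a ∣? n)) (χ a) (inv n)) ⟩
    ∑ X (λ n → 𝟙 (a ∣? n) ℚ.* (χ a ℚ.* inv n))
      ≡⟨ ∑-multiples a X (λ n → χ a ℚ.* inv n) ⟩
    ∑ X (λ m → 𝟙 (a * m <? X) ℚ.* (χ a ℚ.* inv (a * m)))
      ≡⟨ ∑-cong X (λ m _ → trans (cong (λ y → 𝟙 (a * m <? X) ℚ.* (χ a ℚ.* y)) (inv-* a m))
           (solve 4 (λ p c i j → p :* (c :* (i :* j)) := j :* (p :* (c :* i))) refl (𝟙 (a * m <? X)) (χ a) (inv a) (inv m))) ⟩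
    ∑ X (λ m → inv m ℚ.* (𝟙 (a * m <? X) ℚ.* χ-inv a)) ∎
  -- For fixed `m` the condition a m < X cuts out an initial segment of the series of χ(a)/a, whose
  -- sum is at most 1.
  column : ∀ m → ∑ X (λ a → inv m ℚ.* (𝟙 (a * m <? X) ℚ.* χ-inv a)) ≤ℚ inv m
  column m = begin
    ∑ X (λ a → inv m ℚ.* (𝟙 (a * m <? X) ℚ.* χ-inv a))
      ≡⟨ ∑-*ˡ X (inv m) (λ a → 𝟙 (a * m <? X) ℚ.* χ-inv a) ⟩
    inv m ℚ.* ∑ X (λ a → 𝟙 (a * m <? X) ℚ.* χ-inv a)
      ≤⟨ *-monoˡ (inv-nonneg m) (∑-downset≤ (λ a → a * m <? X) (λ i≤j → ℕₚ.≤-<-trans (ℕₚ.*-monoˡ-≤ m i≤j)) χ-prefix X) ⟩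
    inv m ℚ.* 1ℚ
      ≡⟨ ℚₚ.*-identityʳ (inv m) ⟩
    inv m ∎

-- Divergence over inert numbers

odd : ℕ → ℕ
odd i = suc (2 * i)

odd-injective : ∀ {i j} → odd i ≡ odd j → i ≡ j
odd-injective {i} {j} e = ℕₚ.*-cancelˡ-≡ i j 2 (ℕₚ.suc-injective e)

2∤odd : ∀ i → ¬ 2 ∣ odd i
2∤odd i 2∣ = contradiction (∣1⇒≡1 (∣m+n∣m⇒∣n (subst (2 ∣_) (ℕₚ.+-comm 1 (2 * i)) 2∣) (m∣m*n i))) λ ()

L : ℕ → ℚ
L N = ∑ N (λ i → inv (odd i))

-- The parts of the decomposition of 2i+1 divide it, hence lie below 2N, so 1/(2i+1) occurs in the
-- expanded product. The product u v w² determines `i`, so each term of the expansion is charged at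
-- most once.
L≤FVW : ∀ N → L N ≤ℚ F (2 * N) ℚ.* V (2 * N) ℚ.* W (2 * N)
L≤FVW N = begin
  ∑ N (λ i → inv (odd i))
    ≤⟨ ∑-mono N decomposed ⟩
  ∑ N (λ i → ∑ x λ u → ∑ x λ v → ∑ x λ w → term i u v w)
    ≡⟨ ∑-swap N x _ ⟩
  ∑ x (λ u → ∑ N λ i → ∑ x λ v → ∑ x λ w → term i u v w)
    ≡⟨ ∑-cong x (λ u _ → ∑-swap N x _) ⟩
  ∑ x (λ u → ∑ x λ v → ∑ N λ i → ∑ x λ w → term i u v w)
    ≡⟨ ∑-cong x (λ u _ → ∑-cong x λ v _ → ∑-swap N x _) ⟩
  ∑ x (λ u → ∑ x λ v → ∑ x λ w → ∑ N λ i → term i u v w)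
    ≤⟨ ∑-mono x (λ u _ → ∑-mono x λ v _ → ∑-mono x λ w _ → at-most-once u v w) ⟩
  ∑ x (λ u → ∑ x λ v → ∑ x λ w → weight u v w)
    ≡⟨ ∑-cong x (λ u _ → ∑-cong x λ v _ → ∑-*ˡ x (split-weight u ℚ.* inert-weight v) (λ w → inv (w * w))) ⟩
  ∑ x (λ u → ∑ x λ v → split-weight u ℚ.* inert-weight v ℚ.* W x)
    ≡⟨ ∑-cong x (λ u _ → trans (∑-*ʳ x (W x) (λ v → split-weight u ℚ.* inert-weight v)) (cong (ℚ._* W x) (∑-*ˡ x (split-weight u) inert-weight))) ⟩
  ∑ x (λ u → split-weight u ℚ.* V x ℚ.* W x)
    ≡⟨ trans (∑-*ʳ x (W x) (λ u → split-weight u ℚ.* V x)) (cong (ℚ._* W x) (∑-*ʳ x (V x) split-weight)) ⟩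
  F x ℚ.* V x ℚ.* W x ∎
  where
  open ℚₚ.≤-Reasoning
  x = 2 * N
  weight : ℕ → ℕ → ℕ → ℚ
  weight u v w = split-weight u ℚ.* inert-weight v ℚ.* inv (w * w)
  weight-nonneg : ∀ u v w → 0ℚ ≤ℚ weight u v w
  weight-nonneg u v w = *-nonneg (*-nonneg (split-weight-nonneg u) (inert-weight-nonneg v)) (inv-nonneg (w * w))
  term : ℕ → ℕ → ℕ → ℕ → ℚ
  term i u v w = 𝟙 (u * v * (w * w) ≟ odd i) ℚ.* weight u v w
  term-nonneg : ∀ i u v w → 0ℚ ≤ℚ term i u v w
  term-nonneg i u v w = *-nonneg (𝟙-nonneg (u * v * (w * w) ≟ odd i)) (weight-nonneg u v w)
  at-most-once : ∀ u v w → ∑ N (λ i → term i u v w) ≤ℚ weight u v w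
  at-most-once u v w = begin
    ∑ N (λ i → term i u v w)
      ≡⟨ ∑-*ʳ N (weight u v w) (λ i → 𝟙 (u * v * (w * w) ≟ odd i)) ⟩
    ∑ N (λ i → 𝟙 (u * v * (w * w) ≟ odd i)) ℚ.* weight u v w
      ≤⟨ *-monoʳ (weight-nonneg u v w) (∑-exclusive≤1 N (λ i → u * v * (w * w) ≟ odd i) λ e e′ → odd-injective (trans (sym e) e′)) ⟩
    1ℚ ℚ.* weight u v w
      ≡⟨ ℚₚ.*-identityˡ _ ⟩
    weight u v w ∎
  decomposed : ∀ i → i < N → inv (odd i) ≤ℚ ∑ x (λ u → ∑ x λ v → ∑ x λ w → term i u v w)
  decomposed i i<N = begin
    inv (odd i)
      ≡⟨ cong inv eq ⟩
    inv (u * v * (w * w))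
      ≡⟨ trans (inv-* (u * v) (w * w)) (cong (ℚ._* inv (w * w)) (inv-* u v)) ⟩
    inv u ℚ.* inv v ℚ.* inv (w * w)
      ≡⟨ solve 3 (λ a b c → a :* b :* c := con 1ℚ :* (con 1ℚ :* a :* (con 1ℚ :* b) :* c)) refl (inv u) (inv v) (inv (w * w)) ⟩
    1ℚ ℚ.* (1ℚ ℚ.* inv u ℚ.* (1ℚ ℚ.* inv v) ℚ.* inv (w * w))
      ≡⟨ cong₂ ℚ._*_ (𝟙-yes (u * v * (w * w) ≟ odd i) (sym eq))
           (cong₂ (λ y z → y ℚ.* inv u ℚ.* (z ℚ.* inv v) ℚ.* inv (w * w)) (𝟙-yes (split? u) split) (𝟙-yes (inert? v) inert)) ⟨
    term i u v w
      ≤⟨ term≤∑ w (<x (divides (u * v * w) (trans eq (sym (ℕₚ.*-assoc (u * v) w w))))) (term-nonneg i u v) ⟩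
    ∑ x (λ w → term i u v w)
      ≤⟨ term≤∑ v (<x (∣-trans (n∣m*n u) uv∣)) (λ v → ∑-nonneg x λ w _ → term-nonneg i u v w) ⟩
    ∑ x (λ v → ∑ x λ w → term i u v w)
      ≤⟨ term≤∑ u (<x (∣-trans (m∣m*n v) uv∣)) (λ u → ∑-nonneg x λ v _ → ∑-nonneg x λ w _ → term-nonneg i u v w) ⟩
    ∑ x (λ u → ∑ x λ v → ∑ x λ w → term i u v w) ∎
    where
    open Decomposition (decompose (odd i) (2∤odd i))
    uv∣ : u * v ∣ odd i
    uv∣ = subst (u * v ∣_) (sym eq) (m∣m*n (w * w))
    <x : ∀ {d} → d ∣ odd i → d < x
    <x d∣ = ℕₚ.≤-<-trans (∣⇒≤ d∣) (ℕₚ.≤-trans (ℕₚ.≤-reflexive (sym (ℕₚ.*-suc 2 i))) (ℕₚ.*-monoʳ-≤ 2 i<N))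

inv-suc : ∀ n → inv (suc n) ≡ inv (suc n) ℚ.* inv (suc (suc n)) ℚ.+ inv (suc (suc n))
inv-suc n = begin
  a                           ≡⟨ ℚₚ.*-identityʳ a ⟨
  a ℚ.* 1ℚ                    ≡⟨ cong (a ℚ.*_) (ι*inv (suc n)) ⟨
  a ℚ.* ((1ℚ ℚ.+ c) ℚ.* b)    ≡⟨ solve 3 (λ a b c → a :* ((con 1ℚ :+ c) :* b) := a :* b :+ c :* a :* b) refl a b c ⟩
  a ℚ.* b ℚ.+ c ℚ.* a ℚ.* b   ≡⟨ cong (λ y → a ℚ.* b ℚ.+ y ℚ.* b) (ι*inv n) ⟩
  a ℚ.* b ℚ.+ 1ℚ ℚ.* b        ≡⟨ cong (a ℚ.* b ℚ.+_) (ℚₚ.*-identityˡ b) ⟩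
  a ℚ.* b ℚ.+ b               ∎
  where
  open ≡-Reasoning
  a = inv (suc n)
  b = inv (suc (suc n))
  c = ι (suc n)

-- Telescoping by 1/(n+2)² ≤ 1/(n+1) - 1/(n+2). The added reciprocal bounds the tail and makes the
-- induction close, starting from the equality 1 + 1 = 2.
W+inv≤2 : ∀ n → W (2 + n) ℚ.+ inv (suc n) ≤ℚ ι 2
W+inv≤2 zero    = ℚₚ.≤-reflexive refl
W+inv≤2 (suc n) = begin
  W (2 + n) ℚ.+ inv ((2 + n) * (2 + n)) ℚ.+ b
    ≡⟨ cong (λ y → W (2 + n) ℚ.+ y ℚ.+ b) (inv-* (2 + n) (2 + n)) ⟩
  W (2 + n) ℚ.+ b ℚ.* b ℚ.+ b
    ≤⟨ ℚₚ.+-monoˡ-≤ b (ℚₚ.+-monoʳ-≤ (W (2 + n)) (*-monoʳ (inv-nonneg (2 + n)) (inv-antimono (ℕₚ.n≤1+n (suc n))))) ⟩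
  W (2 + n) ℚ.+ a ℚ.* b ℚ.+ b
    ≡⟨ ℚₚ.+-assoc (W (2 + n)) (a ℚ.* b) b ⟩
  W (2 + n) ℚ.+ (a ℚ.* b ℚ.+ b)
    ≡⟨ cong (W (2 + n) ℚ.+_) (inv-suc n) ⟨
  W (2 + n) ℚ.+ a
    ≤⟨ W+inv≤2 n ⟩
  ι 2 ∎
  where
  open ℚₚ.≤-Reasoning
  a = inv (suc n)
  b = inv (suc (suc n))

W≤2 : ∀ x → W x ≤ℚ ι 2
W≤2 x = ℚₚ.≤-trans (∑-extend (ℕₚ.m≤n+m x 2) λ w → inv-nonneg (w * w))
  (ℚₚ.≤-trans (≤-+ʳ (inv-nonneg (suc x))) (W+inv≤2 x))

ι*inv-nonZero : ∀ n → .{{NonZero n}} → ι n ℚ.* inv n ≡ 1ℚ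
ι*inv-nonZero (suc n) = ι*inv n

∑-double : ∀ M f → ∑ (2 * M) f ≡ ∑ M f ℚ.+ ∑ M (λ i → f (i + M))
∑-double M f = trans (cong (λ m → ∑ (M + m) f) (ℕₚ.+-identityʳ M)) (∑-split M M f)

-- The block from M to 2M has M terms of size at most 1/M and adds at most 1. The base case is 0
-- because `H 1` consists of `inv 0`.
H-dyadic : ∀ j → H (2 ^ j) ≤ℚ ι j
H-dyadic zero    = ℚₚ.≤-refl
H-dyadic (suc j) = begin
  H (2 * M)                            ≡⟨ ∑-double M inv ⟩
  H M ℚ.+ ∑ M (λ i → inv (i + M))      ≤⟨ ℚₚ.+-mono-≤ (H-dyadic j) (∑-mono M λ i _ → antimono (ℕₚ.m≤n+m M i)) ⟩
  ι j ℚ.+ ∑ M (λ _ → inv M)            ≡⟨ cong (ι j ℚ.+_) (trans (∑-const M (inv M)) (ι*inv-nonZero M)) ⟩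
  ι j ℚ.+ 1ℚ                           ≡⟨ ℚₚ.+-comm (ι j) 1ℚ ⟩
  ι (suc j)                            ∎
  where
  open ℚₚ.≤-Reasoning
  M = 2 ^ j
  instance
    _ : NonZero M
    _ = ℕₚ.m^n≢0 2 j
  antimono : ∀ {m n} → .{{NonZero m}} → m ≤ n → inv n ≤ℚ inv m
  antimono {suc m} = inv-antimono

-- Doubling the range adds M reciprocals of odd numbers below 4M, hence at least 1/4.
L-dyadic : ∀ k → ι k ℚ.* inv 4 ≤ℚ L (2 ^ k)
L-dyadic zero    = ℚₚ.≤-trans (ℚₚ.≤-reflexive (ℚₚ.*-zeroˡ (inv 4))) (+-nonneg ℚₚ.≤-refl (inv-nonneg 1))
L-dyadic (suc k) = begin
  (1ℚ ℚ.+ ι k) ℚ.* inv 4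
    ≡⟨ solve 2 (λ a b → (con 1ℚ :+ a) :* b := a :* b :+ b :* con 1ℚ) refl (ι k) (inv 4) ⟩
  ι k ℚ.* inv 4 ℚ.+ inv 4 ℚ.* 1ℚ
    ≤⟨ ℚₚ.+-monoˡ-≤ (inv 4 ℚ.* 1ℚ) (L-dyadic k) ⟩
  L M ℚ.+ inv 4 ℚ.* 1ℚ
    ≡⟨ cong (λ y → L M ℚ.+ inv 4 ℚ.* y) (ι*inv-nonZero M) ⟨
  L M ℚ.+ inv 4 ℚ.* (ι M ℚ.* inv M)
    ≡⟨ cong (L M ℚ.+_) (trans (solve 3 (λ a b c → a :* (b :* c) := b :* (a :* c)) refl (inv 4) (ι M) (inv M))
         (cong (ι M ℚ.*_) (sym (inv-* 4 M)))) ⟩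
  L M ℚ.+ ι M ℚ.* inv (4 * M)
    ≡⟨ cong (L M ℚ.+_) (∑-const M (inv (4 * M))) ⟨
  L M ℚ.+ ∑ M (λ _ → inv (4 * M))
    ≤⟨ ℚₚ.+-monoʳ-≤ (L M) (∑-mono M λ i i<M → inv-antimono (bound i i<M)) ⟩
  L M ℚ.+ ∑ M (λ i → inv (odd (i + M)))
    ≡⟨ ∑-double M (λ i → inv (odd i)) ⟨
  L (2 * M) ∎
  where
  open ℚₚ.≤-Reasoning
  M = 2 ^ k
  instance
    _ : NonZero M
    _ = ℕₚ.m^n≢0 2 k
  four : ∀ M → 2 * (M + M) ≡ 4 * M
  four = solve-∀
  bound : ∀ i → i < M → odd (i + M) ≤ 4 * M
  bound i i<M = ℕₚ.≤-trans (ℕₚ.≤-trans (ℕₚ.n≤1+n _) (ℕₚ.≤-reflexive (sym (ℕₚ.*-suc 2 (i + M)))))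
    (ℕₚ.≤-trans (ℕₚ.*-monoʳ-≤ 2 (ℕₚ.+-monoˡ-< M i<M)) (ℕₚ.≤-reflexive (four M)))

square-mono : ∀ {a b} → 0ℚ ≤ℚ a → a ≤ℚ b → a ℚ.* a ≤ℚ b ℚ.* b
square-mono 0≤a a≤b = *-mono (ℚₚ.≤-trans 0≤a a≤b) 0≤a a≤b a≤b

V-unbounded : ∀ K → ∃[ x ] ι K ≤ℚ V x
V-unbounded K = x , large (ℚₚ.≤-total (ι K) (V x))
  where
  -- With x = 2 ^ (k+1), the dyadic bounds give k/4 ≤ F V W, F² ≤ H(x²) ≤ 2(k+1) and W ≤ 2. If V ≤
  -- K, squaring yields k² ≤ 16 · 2(k+1) · K² · 4 = 128 (k+1) K², and k + 1 ≤ 2k would give k ≤ 256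
  -- K².
  k = suc (256 * (K * K))
  x = 2 * 2 ^ k
  V-nonneg : 0ℚ ≤ℚ V x
  V-nonneg = ∑-nonneg x λ v _ → inert-weight-nonneg v
  W-nonneg : 0ℚ ≤ℚ W x
  W-nonneg = ∑-nonneg x λ w _ → inv-nonneg (w * w)
  x²≡ : x * x ≡ 2 ^ (suc k + suc k)
  x²≡ = sym (ℕₚ.^-distribˡ-+-* 2 (suc k) (suc k))
  main : V x ≤ℚ ι K → ι (k * k) ≤ℚ ι (128 * (suc k * (K * K)))
  main V≤K = begin
    ι (k * k)
      ≡⟨ ι-* k k ⟩
    ι k ℚ.* ι k
      ≡⟨ solve 1 (λ a → a :* a := con (ι 16) :* (a :* con (inv 4) :* (a :* con (inv 4)))) refl (ι k) ⟩
    ι 16 ℚ.* (ι k ℚ.* inv 4 ℚ.* (ι k ℚ.* inv 4))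
      ≤⟨ *-monoˡ (ι-nonneg 16) (square-mono (*-nonneg (ι-nonneg k) (inv-nonneg 4)) (ℚₚ.≤-trans (L-dyadic k) (L≤FVW (2 ^ k)))) ⟩
    ι 16 ℚ.* (F x ℚ.* V x ℚ.* W x ℚ.* (F x ℚ.* V x ℚ.* W x))
      ≡⟨ solve 4 (λ c f v w → c :* (f :* v :* w :* (f :* v :* w)) := c :* (f :* f :* (v :* v) :* (w :* w))) refl (ι 16) (F x) (V x) (W x) ⟩
    ι 16 ℚ.* (F x ℚ.* F x ℚ.* (V x ℚ.* V x) ℚ.* (W x ℚ.* W x))
      ≤⟨ *-monoˡ (ι-nonneg 16) (*-mono (*-nonneg (ι-nonneg (suc k + suc k)) (*-nonneg (ι-nonneg K) (ι-nonneg K))) (*-nonneg W-nonneg W-nonneg)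
           (*-mono (ι-nonneg (suc k + suc k)) (*-nonneg V-nonneg V-nonneg) F²≤ (square-mono V-nonneg V≤K))
           (square-mono W-nonneg (W≤2 x))) ⟩
    ι 16 ℚ.* (ι (suc k + suc k) ℚ.* (ι K ℚ.* ι K) ℚ.* (ι 2 ℚ.* ι 2))
      ≡⟨ cong₂ (λ y z → ι 16 ℚ.* (ι (suc k + suc k) ℚ.* y ℚ.* z)) (ι-* K K) (ι-* 2 2) ⟨
    ι 16 ℚ.* (ι (suc k + suc k) ℚ.* ι (K * K) ℚ.* ι 4)
      ≡⟨ trans (ι-* 16 ((suc k + suc k) * (K * K) * 4)) (cong (ι 16 ℚ.*_) (trans (ι-* ((suc k + suc k) * (K * K)) 4) (cong (ℚ._* ι 4) (ι-* (suc k + suc k) (K * K))))) ⟨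
    ι (16 * ((suc k + suc k) * (K * K) * 4))
      ≡⟨ cong ι (collect (suc k) (K * K)) ⟩
    ι (128 * (suc k * (K * K))) ∎
    where
    open ℚₚ.≤-Reasoning
    collect : ∀ a b → 16 * ((a + a) * b * 4) ≡ 128 * (a * b)
    collect = solve-∀
    F²≤ : F x ℚ.* F x ≤ℚ ι (suc k + suc k)
    F²≤ = ℚₚ.≤-trans (F²≤H x) (subst (λ y → H y ≤ℚ ι (suc k + suc k)) (sym x²≡) (H-dyadic (suc k + suc k)))
  impossible : ¬ k * k ≤ 128 * (suc k * (K * K))
  impossible p = ℕₚ.<-irrefl refl (begin-strict
    128 * (suc k * (K * K))      ≤⟨ ℕₚ.*-monoʳ-≤ 128 (ℕₚ.*-monoˡ-≤ (K * K) (ℕₚ.+-monoˡ-≤ k {1} {k} (s≤s z≤n))) ⟩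
    128 * ((k + k) * (K * K))    ≡⟨ regroup k (K * K) ⟩
    256 * (K * K) * k            <⟨ ℕₚ.m<n+m (256 * (K * K) * k) (s≤s z≤n) ⟩
    k * k                        ≤⟨ p ⟩
    128 * (suc k * (K * K))      ∎)
    where
    open ℕₚ.≤-Reasoning
    regroup : ∀ a b → 128 * ((a + a) * b) ≡ 256 * b * a
    regroup = solve-∀
  large : ι K ≤ℚ V x ⊎ V x ≤ℚ ι K → ι K ≤ℚ V x
  large (inj₁ p) = p
  large (inj₂ p) = ⊥-elim (impossible (ι-cancel-≤ (main p)))

-- Densities modulo (x !) ^ k

-- `g` is a power of p² times a number prime to `p`. The inductive form follows the descent that
-- removes p² at each step.
data EvenValuation (p : ℕ) : ℕ → Set where
  coprime : ∀ {g} → ¬ p ∣ g → EvenValuation p g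
  *p²     : ∀ {g} → EvenValuation p g → EvenValuation p (g * (p * p))

-- The valuation at `p` is odd on the left and even on the right. If p² can be split off `h`,
-- cancelling one `p` exchanges the roles of the two sides, so the recursion shortens the two
-- derivations alternately.
odd-even-valuation : ∀ {p} → Prime p → ∀ {a b g h} → ¬ p ∣ a → ¬ p ∣ b →
  EvenValuation p g → EvenValuation p h → ¬ a * p * g ≡ b * h
odd-even-valuation {p} pp {a} {b} {g} {h} p∤a p∤b eg (coprime p∤h) e
  with euclidsLemma b h pp (subst (p ∣_) e (∣m⇒∣m*n g (n∣m*n a)))
... | inj₁ p∣b = p∤b p∣b
... | inj₂ p∣h = p∤h p∣h
odd-even-valuation {p} pp {a} {b} {g} p∤a p∤b eg (*p² {h} eh) e =
  odd-even-valuation pp p∤b p∤a eh eg (ℕₚ.*-cancelʳ-≡ (b * p * h) (a * g) p {{prime⇒nonZero pp}}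
    (trans (left b p h) (trans (sym e) (right a p g))))
  where
  left : ∀ b p h → b * p * h * p ≡ b * (h * (p * p))
  left = solve-∀
  right : ∀ a p g → a * p * g ≡ a * g * p
  right = solve-∀

-- The equation is the congruence g ≡ a² + b² modulo `p ^ k`, written with multiples on both sides
-- to avoid subtraction. If `p` divides `g` and k ≥ 2, it divides `a` and `b`; dividing by p² leaves
-- the same situation modulo `p ^ (k - 2)`. For k ≤ 1 this case contradicts that `p ^ k` does not
-- divide `g`.
even-valuation : ∀ {p} → Prime p → p % 4 ≡ 3 → ∀ k g a b c d →
  g + c * p ^ k ≡ a * a + b * b + d * p ^ k → ¬ p ^ k ∣ g → EvenValuation p g
even-valuation pp p3 zero g a b c d e ∤g = ⊥-elim (∤g (1∣ g))
even-valuation {p} pp p3 (suc k) g a b c d e ∤g with p ∣? g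
... | no p∤g = coprime p∤g
even-valuation {p} pp p3 (suc zero) g a b c d e ∤g | yes p∣g = ⊥-elim (∤g (subst (_∣ g) (sym (ℕₚ.*-identityʳ p)) p∣g))
even-valuation {p} pp p3 (suc (suc k)) g a b c d e ∤g | yes p∣g =
  descend (sum-of-squares-divisor p pp p3 a b p∣a²+b²)
          (sum-of-squares-divisor p pp p3 b a (subst (p ∣_) (ℕₚ.+-comm (a * a) (b * b)) p∣a²+b²))
  where
  P = p ^ suc (suc k)
  p²∣P : p * p ∣ P
  p²∣P = divides (p ^ k) (trans (sym (ℕₚ.*-assoc p p (p ^ k))) (ℕₚ.*-comm (p * p) (p ^ k)))
  p∣P : p ∣ P
  p∣P = m∣m*n (p ^ suc k)
  p∣a²+b² : p ∣ a * a + b * b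
  p∣a²+b² = ∣m+n∣m⇒∣n (subst (p ∣_) (trans e (ℕₚ.+-comm (a * a + b * b) (d * P))) (∣m∣n⇒∣m+n p∣g (∣n⇒∣m*n c p∣P))) (∣n⇒∣m*n d p∣P)
  descend : p ∣ a → p ∣ b → EvenValuation p g
  descend (divides a′ refl) (divides b′ refl) with ∣m+n∣m⇒∣n (subst (p * p ∣_) (trans (sym e) (ℕₚ.+-comm g (c * P)))
      (∣m∣n⇒∣m+n (divides (a′ * a′ + b′ * b′) (square a′ b′ p)) (∣n⇒∣m*n d p²∣P))) (∣n⇒∣m*n c p²∣P)
    where
    square : ∀ a b p → a * p * (a * p) + b * p * (b * p) ≡ (a * a + b * b) * (p * p)
    square = solve-∀
  ... | divides g′ refl = *p² (even-valuation pp p3 k g′ a′ b′ c d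
      (ℕₚ.*-cancelʳ-≡ _ _ (p * p) {{ℕₚ.m*n≢0 p p {{prime⇒nonZero pp}} {{prime⇒nonZero pp}}}}
        (trans (left g′ c p (p ^ k)) (trans e (right a′ b′ d p (p ^ k)))))
      (λ d′ → ∤g (subst (_∣ g′ * (p * p)) (sym (pull p (p ^ k))) (*-monoˡ-∣ (p * p) d′))))
    where
    left : ∀ g c p q → (g + c * q) * (p * p) ≡ g * (p * p) + c * (p * (p * q))
    left = solve-∀
    right : ∀ a b d p q → a * p * (a * p) + b * p * (b * p) + d * (p * (p * q)) ≡ (a * a + b * b + d * q) * (p * p)
    right = solve-∀
    pull : ∀ p q → p * (p * q) ≡ q * (p * p)
    pull = solve-∀

-- By squarefreeness a prime of `v` does not divide the product of the remaining ones, so when that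
-- product divides `v′` the prime must divide the cofactor.
inert-∣-by-primes : ∀ {v v′} → Inert v → (∀ {p} → Prime p → p ∣ v → p ∣ v′) → v ∣ v′
inert-∣-by-primes {zero} iv _ = ⊥-elim (inert≢0 {0} iv refl)
inert-∣-by-primes {v@(suc _)} {v′} iv h = subst (_∣ v′) (sym isFactorisation)
    (go factors factorsPrime (subst Inert isFactorisation iv) (λ pp p∣ → h pp (subst (_ ∣_) (sym isFactorisation) p∣)))
  where
  open PrimeFactorisation (factorise v)
  go : ∀ ps → All Prime ps → Inert (product ps) → (∀ {p} → Prime p → p ∣ product ps → p ∣ v′) → product ps ∣ v′
  go []       _          _  _ = 1∣ v′
  go (p ∷ ps) (pp ∷ pps) iv h with go ps pps (inert-∣ {p * product ps} (n∣m*n p) iv) (λ pq q∣ → h pq (∣n⇒∣m*n p q∣))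
  ... | divides c refl with euclidsLemma c (product ps) pp (h pp (m∣m*n (product ps)))
  ...   | inj₁ p∣c  = *-monoˡ-∣ (product ps) p∣c
  ...   | inj₂ p∣ps = ⊥-elim (proj₂ (iv pp (m∣m*n (product ps))) (*-monoʳ-∣ p p∣ps))

∑-cons : ∀ n f → ∑ (suc n) f ≡ f 0 ℚ.+ ∑ n (f ∘ suc)
∑-cons zero    f = ℚₚ.+-comm 0ℚ (f 0)
∑-cons (suc n) f = trans (cong (ℚ._+ f (suc n)) (∑-cons n f)) (ℚₚ.+-assoc (f 0) _ _)

ι-length-filter : ∀ {A : Set} {P : A → Set} (P? : ∀ a → Dec (P a)) n (f : Fin n → A) (g : ℕ → ℚ) →
  (∀ i → 𝟙 (P? (f i)) ≡ g (toℕ i)) → ι (length (filter P? (tabulate f))) ≡ ∑ n g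
ι-length-filter P? zero    f g h = refl
ι-length-filter P? (suc n) f g h with P? (f Fin.zero) | h Fin.zero | ι-length-filter P? n (f ∘ Fin.suc) (g ∘ suc) (λ i → h (Fin.suc i))
... | yes _ | h₀ | ih = trans (cong₂ ℚ._+_ h₀ ih) (sym (∑-cons n g))
... | no  _ | h₀ | ih = trans ih (trans (sym (ℚₚ.+-identityˡ _)) (trans (cong (ℚ._+ ∑ n (g ∘ suc)) h₀) (sym (∑-cons n g))))

toℕ-mod : ∀ m n .{{_ : NonZero n}} → toℕ (m mod n) ≡ m % n
toℕ-mod m n = toℕ-fromℕ< (m%n<n m n)

cardS-∑ : ∀ n .{{_ : NonZero n}} → ι (cardS n) ≡ ∑ n (λ m → 𝟙 (InS? n (m mod n)))
cardS-∑ n = ι-length-filter (InS? n) n (λ i → i) _ λ i →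
  cong (λ j → 𝟙 (InS? n j)) (sym (toℕ-injective (trans (toℕ-mod (toℕ i) n) (m<n⇒m%n≡m (toℕ<n i)))))

-- Multiplication by `v` sends `m` to the first element of the `m`-th block of length `v`.
∑-scale : ∀ {A B : ℕ → Set} (a? : ∀ i → Dec (A i)) (b? : ∀ i → Dec (B i)) v → .{{NonZero v}} →
  (∀ m → A m → B (m * v)) → ∀ Z → ∑ Z (λ m → 𝟙 (a? m)) ≤ℚ ∑ (Z * v) (λ t → 𝟙 (b? t))
∑-scale a? b? v h zero    = ℚₚ.≤-refl
∑-scale a? b? v@(suc _) h (suc Z) = ℚₚ.≤-trans
  (ℚₚ.+-mono-≤ (∑-scale a? b? v h Z) (ℚₚ.≤-trans (𝟙-mono (a? Z) (b? (Z * v)) (h Z))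
    (term≤∑ {v} {λ i → 𝟙 (b? (i + Z * v))} 0 (s≤s z≤n) (λ i → 𝟙-nonneg (b? (i + Z * v))))))
  (ℚₚ.≤-reflexive (sym (∑-split (Z * v) v (λ t → 𝟙 (b? t)))))

∑-periodic : ∀ n f → (∀ i → f (i + n) ≡ f i) → ∀ q → ∑ (q * n) f ≡ ι q ℚ.* ∑ n f
∑-periodic n f period zero    = sym (ℚₚ.*-zeroˡ (∑ n f))
∑-periodic n f period (suc q) = trans (∑-split (q * n) n f) (trans
  (cong₂ ℚ._+_ (∑-periodic n f period q) (∑-cong n λ i _ → shift q i))
  (solve 2 (λ a b → a :* b :+ b := (con 1ℚ :+ a) :* b) refl (ι q) (∑ n f)))
  where
  shift : ∀ q i → f (i + q * n) ≡ f i
  shift zero    i = cong f (ℕₚ.+-identityʳ i)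
  shift (suc q) i = trans (cong f (trans (cong (i +_) (ℕₚ.+-comm n (q * n))) (sym (ℕₚ.+-assoc i (q * n) n)))) (trans (period (i + q * n)) (shift q i))

∑-blocks : ∀ D f → (∀ j → ∑ D (λ i → f (i + j * D)) ≤ℚ 1ℚ) → ∀ q → ∑ (q * D) f ≤ℚ ι q
∑-blocks D f block zero    = ℚₚ.≤-refl
∑-blocks D f block (suc q) = ℚₚ.≤-trans (ℚₚ.≤-reflexive (∑-split (q * D) D f))
  (ℚₚ.≤-trans (ℚₚ.+-mono-≤ (∑-blocks D f block q) (block q)) (ℚₚ.≤-reflexive (ℚₚ.+-comm (ι q) 1ℚ)))

∣! : ∀ {d x} → .{{NonZero d}} → d ≤ x → d ∣ x !
∣! {suc d} d≤x = ∣-trans (m∣m*n (d !)) (m≤n⇒m!∣n! d≤x)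

^-mono-∣ : ∀ {d m} k → d ∣ m → d ^ k ∣ m ^ k
^-mono-∣ zero    d∣m = ∣-refl
^-mono-∣ (suc k) d∣m = *-pres-∣ d∣m (^-mono-∣ k d∣m)

ι-*-cancel : ∀ m → .{{NonZero m}} → ∀ {a b} → ι m ℚ.* a ≤ℚ ι m ℚ.* b → a ≤ℚ b
ι-*-cancel (suc m) = ℚₚ.*-cancelˡ-≤-pos (ι (suc m)) {{ι-positive m}}

module Density (x k : ℕ) where

  -- The factorial is a multiple of every inert `v` < x, so that M / v periods are a whole number,
  -- and of every `d` with 2 ≤ d < x, so that `d ^ k` divides `n`.
  M n : ℕ
  M = x !
  n = M ^ k

  instance
    M≢0 : NonZero M
    M≢0 = x ℕₚ.!≢0
    n≢0 : NonZero n
    n≢0 = ℕₚ.m^n≢0 M k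

  -- All three are predicates on natural numbers, read modulo `n`, so that multiples m v can leave
  -- the range below `n`. `Bad` collects the numbers on which the congruence may fail to force an
  -- even valuation.
  SumSq Bad Good : ℕ → Set
  SumSq m = InS n (m mod n)
  Bad m = ∃[ d ] (d < x × (2 ≤ d × d ^ k ∣ m))
  Good m = SumSq m × ¬ Bad m

  sumSq? : ∀ m → Dec (SumSq m)
  sumSq? m = InS? n (m mod n)

  bad-at? : ∀ m d → Dec (2 ≤ d × d ^ k ∣ m)
  bad-at? m d = 2 ≤? d ×-dec d ^ k ∣? m

  bad? : ∀ m → Dec (Bad m)
  bad? m = ℕₚ.anyUpTo? (bad-at? m) x

  good? : ∀ m → Dec (Good m)
  good? m = sumSq? m ×-dec ¬? (bad? m)

  d^k∣n : ∀ {d} → 2 ≤ d → d < x → d ^ k ∣ n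
  d^k∣n 2≤d d<x = ^-mono-∣ k (∣! {{>-nonZero (ℕₚ.≤-trans (s≤s z≤n) 2≤d)}} (ℕₚ.<⇒≤ d<x))

  good-periodic : ∀ m → 𝟙 (good? (m + n)) ≡ 𝟙 (good? m)
  good-periodic m = 𝟙-cong (good? (m + n)) (good? m)
    (λ (s , ¬b) → subst (InS n) residue s , λ (d , d<x , 2≤d , ∣m) → ¬b (d , d<x , 2≤d , ∣m∣n⇒∣m+n ∣m (d^k∣n 2≤d d<x)))
    (λ (s , ¬b) → subst (InS n) (sym residue) s , λ (d , d<x , 2≤d , ∣m+n) →
      ¬b (d , d<x , 2≤d , ∣m+n∣m⇒∣n (subst (d ^ k ∣_) (ℕₚ.+-comm m n) ∣m+n) (d^k∣n 2≤d d<x)))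
    where
    residue : (m + n) mod n ≡ m mod n
    residue = toℕ-injective (trans (toℕ-mod (m + n) n) (trans ([m+n]%n≡m%n m n) (sym (toℕ-mod m n))))

  good-even-valuation : ∀ {p m} → Prime p → p % 4 ≡ 3 → p < x → Good m → EvenValuation p m
  good-even-valuation {p} {m} pp p3 p<x ((a , b , e) , ¬bad) with d^k∣n {p} (nonTrivial⇒n>1 p {{prime⇒nonTrivial pp}}) p<x
  ... | divides n′ n≡ = even-valuation pp p3 k m (toℕ a) (toℕ b) (s / n * n′) (m / n * n′) congruence
      (λ p^k∣m → ¬bad (p , p<x , nonTrivial⇒n>1 p {{prime⇒nonTrivial pp}} , p^k∣m))
    where
    s = toℕ a * toℕ a + toℕ b * toℕ b
    swap : ∀ r q t → r + q + t ≡ r + t + q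
    swap = solve-∀
    split-n : ∀ c → c * n′ * p ^ k ≡ c * n
    split-n c = trans (ℕₚ.*-assoc c n′ (p ^ k)) (cong (c *_) (sym n≡))
    congruence : m + s / n * n′ * p ^ k ≡ s + m / n * n′ * p ^ k
    congruence = begin
      m + s / n * n′ * p ^ k              ≡⟨ cong₂ _+_ (m≡m%n+[m/n]*n m n) (split-n (s / n)) ⟩
      m % n + m / n * n + s / n * n       ≡⟨ swap (m % n) (m / n * n) (s / n * n) ⟩
      m % n + s / n * n + m / n * n       ≡⟨ cong (λ r → r + s / n * n + m / n * n) (trans e (toℕ-mod m n)) ⟨
      s % n + s / n * n + m / n * n       ≡⟨ cong₂ _+_ (m≡m%n+[m/n]*n s n) (split-n (m / n)) ⟨
      s + m / n * n′ * p ^ k              ∎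
      where open ≡-Reasoning

  Hit : ℕ → ℕ → Set
  Hit t v = v < x × Inert v × ∃[ m ] (m < suc t × (m * v ≡ t × Good m))

  hit? : ∀ t v → Dec (Hit t v)
  hit? t v = v <? x ×-dec inert? v ×-dec ℕₚ.anyUpTo? (λ m → m * v ≟ t ×-dec good? m) (suc t)

  -- If `p` divided `v` but not `v′`, the common value `t` would have odd valuation at `p` as m v
  -- and even valuation as m′ v′. By symmetry `t` determines `v`.
  hit-∣ : ∀ {t v v′} → Hit t v → Hit t v′ → v ∣ v′
  hit-∣ {t} {v} {v′} (v<x , iv , m , _ , refl , gm) (_ , _ , m′ , _ , e , gm′) = inert-∣-by-primes iv divides-v′
    where
    divides-v′ : ∀ {p} → Prime p → p ∣ v → p ∣ v′
    divides-v′ {p} pp p∣v@(divides v₀ v≡) with p ∣? v′ | iv pp p∣v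
    ... | yes p∣v′ | _ = p∣v′
    ... | no  p∤v′ | p3 , p²∤v = ⊥-elim (odd-even-valuation pp p∤v₀ p∤v′ (even gm) (even gm′) (begin
        v₀ * p * m  ≡⟨ cong (_* m) v≡ ⟨
        v * m       ≡⟨ ℕₚ.*-comm v m ⟩
        m * v       ≡⟨ e ⟨
        m′ * v′     ≡⟨ ℕₚ.*-comm m′ v′ ⟩
        v′ * m′     ∎))
      where
      open ≡-Reasoning
      p<x : p < x
      p<x = ℕₚ.≤-<-trans (∣⇒≤ {{≢-nonZero (inert≢0 {v} iv)}} p∣v) v<x
      even : ∀ {m} → Good m → EvenValuation p m
      even = good-even-valuation pp p3 p<x
      p∤v₀ : ¬ p ∣ v₀
      p∤v₀ p∣v₀ = p²∤v (subst (p * p ∣_) (sym v≡) (*-monoˡ-∣ p p∣v₀))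

  good-count : ℚ
  good-count = ∑ n (λ m → 𝟙 (good? m))

  good-count-nonneg : 0ℚ ≤ℚ good-count
  good-count-nonneg = ∑-nonneg n λ m _ → 𝟙-nonneg (good? m)

  -- Writing M = q v, the good `m` below q n number `q` times `good-count` by periodicity, and their
  -- multiples m v lie below M n. This window has the same length for every `v`.
  hits : ∀ v → v < x → inert-weight v ℚ.* (ι M ℚ.* good-count) ≤ℚ ∑ (M * n) (λ t → 𝟙 (hit? t v))
  hits v v<x = by-cases (inert? v)
    where
    go : Inert v → .{{NonZero v}} → v ∣ M → 1ℚ ℚ.* inv v ℚ.* (ι M ℚ.* good-count) ≤ℚ ∑ (M * n) (λ t → 𝟙 (hit? t v))
    go iv (divides q M≡) = begin
      1ℚ ℚ.* inv v ℚ.* (ι M ℚ.* good-count)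
        ≡⟨ cong (λ y → 1ℚ ℚ.* inv v ℚ.* (y ℚ.* good-count)) (trans (cong ι M≡) (ι-* q v)) ⟩
      1ℚ ℚ.* inv v ℚ.* (ι q ℚ.* ι v ℚ.* good-count)
        ≡⟨ solve 4 (λ i a b c → con 1ℚ :* i :* (a :* b :* c) := b :* i :* (a :* c)) refl (inv v) (ι q) (ι v) good-count ⟩
      ι v ℚ.* inv v ℚ.* (ι q ℚ.* good-count)
        ≡⟨ trans (cong (ℚ._* (ι q ℚ.* good-count)) (ι*inv-nonZero v)) (ℚₚ.*-identityˡ (ι q ℚ.* good-count)) ⟩
      ι q ℚ.* good-count
        ≡⟨ ∑-periodic n (λ m → 𝟙 (good? m)) good-periodic q ⟨
      ∑ (q * n) (λ m → 𝟙 (good? m))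
        ≤⟨ ∑-scale good? (λ t → hit? t v) v (λ m gm → v<x , (λ {p} → iv {p}) , m , s≤s (ℕₚ.m≤m*n m v) , refl , gm) (q * n) ⟩
      ∑ (q * n * v) (λ t → 𝟙 (hit? t v))
        ≡⟨ cong (λ y → ∑ y (λ t → 𝟙 (hit? t v))) (trans (rearrange q n v) (cong (_* n) (sym M≡))) ⟩
      ∑ (M * n) (λ t → 𝟙 (hit? t v)) ∎
      where
      open ℚₚ.≤-Reasoning
      rearrange : ∀ q n v → q * n * v ≡ q * v * n
      rearrange = solve-∀
    by-cases : (d : Dec (Inert v)) → 𝟙 d ℚ.* inv v ℚ.* (ι M ℚ.* good-count) ≤ℚ ∑ (M * n) (λ t → 𝟙 (hit? t v))
    by-cases (no _) = ℚₚ.≤-trans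
      (ℚₚ.≤-reflexive (trans (cong (ℚ._* (ι M ℚ.* good-count)) (ℚₚ.*-zeroˡ (inv v))) (ℚₚ.*-zeroˡ (ι M ℚ.* good-count))))
      (∑-nonneg (M * n) λ t _ → 𝟙-nonneg (hit? t v))
    by-cases (yes iv) = go iv (∣! (ℕₚ.<⇒≤ v<x))
      where
      instance
        v≢0 : NonZero v
        v≢0 = ≢-nonZero (inert≢0 {v} iv)

  -- The sets v · Good, for v < x a squarefree product of primes ≡ 3 (mod 4), are pairwise disjoint:
  -- v is read off an element as the set of such primes having odd valuation.
  V*good≤n : V x ℚ.* good-count ≤ℚ ι n
  V*good≤n = cancel (begin
    V x ℚ.* (ι M ℚ.* good-count)
      ≡⟨ ∑-*ʳ x (ι M ℚ.* good-count) inert-weight ⟨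
    ∑ x (λ v → inert-weight v ℚ.* (ι M ℚ.* good-count))
      ≤⟨ ∑-mono x hits ⟩
    ∑ x (λ v → ∑ (M * n) λ t → 𝟙 (hit? t v))
      ≡⟨ ∑-swap x (M * n) _ ⟩
    ∑ (M * n) (λ t → ∑ x λ v → 𝟙 (hit? t v))
      ≤⟨ ∑-mono (M * n) (λ t _ → ∑-exclusive≤1 x (hit? t) (λ h h′ → ∣-antisym (hit-∣ h h′) (hit-∣ h′ h))) ⟩
    ∑ (M * n) (λ _ → 1ℚ)
      ≡⟨ trans (∑-const (M * n) 1ℚ) (trans (ℚₚ.*-identityʳ (ι (M * n))) (ι-* M n)) ⟩
    ι M ℚ.* ι n ∎)
    where
    open ℚₚ.≤-Reasoning
    cancel : V x ℚ.* (ι M ℚ.* good-count) ≤ℚ ι M ℚ.* ι n → V x ℚ.* good-count ≤ℚ ι n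
    cancel p = ι-*-cancel M (ℚₚ.≤-trans (ℚₚ.≤-reflexive
      (solve 3 (λ m v c → m :* (v :* c) := v :* (m :* c)) refl (ι M) (V x) good-count)) p)

  bad-count : ℚ
  bad-count = ∑ n (λ m → ∑ x λ d → 𝟙 (bad-at? m d))

  bad-count-nonneg : 0ℚ ≤ℚ bad-count
  bad-count-nonneg = ∑-nonneg n λ m _ → ∑-nonneg x λ d _ → 𝟙-nonneg (bad-at? m d)

  cardS≤good+bad : ι (cardS n) ≤ℚ good-count ℚ.+ bad-count
  cardS≤good+bad = begin
    ι (cardS n)                                                       ≡⟨ cardS-∑ n ⟩
    ∑ n (λ m → 𝟙 (sumSq? m))                                          ≤⟨ ∑-mono n (λ m _ → cover m) ⟩
    ∑ n (λ m → 𝟙 (good? m) ℚ.+ ∑ x λ d → 𝟙 (bad-at? m d))             ≡⟨ ∑-+ n _ _ ⟩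
    good-count ℚ.+ bad-count                                          ∎
    where
    open ℚₚ.≤-Reasoning
    cover : ∀ m → 𝟙 (sumSq? m) ≤ℚ 𝟙 (good? m) ℚ.+ ∑ x (λ d → 𝟙 (bad-at? m d))
    cover m = by-cases (bad? m)
      where
      by-cases : Dec (Bad m) → 𝟙 (sumSq? m) ≤ℚ 𝟙 (good? m) ℚ.+ ∑ x (λ d → 𝟙 (bad-at? m d))
      by-cases (no ¬bad) = ℚₚ.≤-trans (𝟙-mono (sumSq? m) (good? m) (λ s → s , ¬bad))
        (≤-+ʳ (∑-nonneg x λ d _ → 𝟙-nonneg (bad-at? m d)))
      by-cases (yes (d , d<x , h)) = ℚₚ.≤-trans (ℚₚ.≤-trans (𝟙-mono (sumSq? m) (bad-at? m d) (λ _ → h))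
          (term≤∑ {f = λ d → 𝟙 (bad-at? m d)} d d<x (λ d → 𝟙-nonneg (bad-at? m d))))
        (≤-+ˡ (𝟙-nonneg (good? m)))

  -- `d ^ k` divides `n`, and each block of that length contains at most one multiple of it, a share
  -- of at most 1 / 2 ^ k.
  bad-row : ∀ d → d < x → ι (2 ^ k) ℚ.* ∑ n (λ m → 𝟙 (bad-at? m d)) ≤ℚ ι n
  bad-row d d<x = by-cases (2 ≤? d)
    where
    D = d ^ k
    f : ℕ → ℚ
    f m = 𝟙 (bad-at? m d)
    block : ∀ j → ∑ D (λ i → f (i + j * D)) ≤ℚ 1ℚ
    block j = ℚₚ.≤-trans (∑-mono D λ i i<D → 𝟙-mono (bad-at? (i + j * D) d) (i ≟ 0)
        λ (_ , D∣) → first i i<D (∣m+n∣m⇒∣n (subst (D ∣_) (ℕₚ.+-comm i (j * D)) D∣) (n∣m*n j)))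
      (∑-exclusive≤1 D (_≟ 0) (λ i≡0 j≡0 → trans i≡0 (sym j≡0)))
      where
      first : ∀ i → i < D → D ∣ i → i ≡ 0
      first zero    _   _   = refl
      first (suc i) i<D D∣i = ⊥-elim (ℕₚ.<⇒≱ i<D (∣⇒≤ D∣i))
    go : 2 ≤ d → D ∣ n → ι (2 ^ k) ℚ.* ∑ n f ≤ℚ ι n
    go 2≤d (divides q n≡) = begin
      ι (2 ^ k) ℚ.* ∑ n f       ≡⟨ cong (λ y → ι (2 ^ k) ℚ.* ∑ y f) n≡ ⟩
      ι (2 ^ k) ℚ.* ∑ (q * D) f ≤⟨ *-mono (ι-nonneg D) (∑-nonneg (q * D) λ m _ → 𝟙-nonneg (bad-at? m d)) (ι-mono (ℕₚ.^-monoˡ-≤ k 2≤d)) (∑-blocks D f block q) ⟩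
      ι D ℚ.* ι q               ≡⟨ trans (ℚₚ.*-comm (ι D) (ι q)) (sym (trans (cong ι n≡) (ι-* q D))) ⟩
      ι n                       ∎
      where open ℚₚ.≤-Reasoning
    by-cases : Dec (2 ≤ d) → ι (2 ^ k) ℚ.* ∑ n f ≤ℚ ι n
    by-cases (no 2≰d) = ℚₚ.≤-trans (ℚₚ.≤-reflexive (trans
      (cong (ι (2 ^ k) ℚ.*_) (∑-zero n λ m _ → 𝟙-no (bad-at? m d) (λ (2≤d , _) → 2≰d 2≤d)))
      (ℚₚ.*-zeroʳ (ι (2 ^ k))))) (ι-nonneg n)
    by-cases (yes 2≤d) = go 2≤d (d^k∣n 2≤d d<x)

  bad-bound : ι (2 ^ k) ℚ.* bad-count ≤ℚ ι x ℚ.* ι n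
  bad-bound = begin
    ι (2 ^ k) ℚ.* bad-count
      ≡⟨ cong (ι (2 ^ k) ℚ.*_) (∑-swap n x _) ⟩
    ι (2 ^ k) ℚ.* ∑ x (λ d → ∑ n λ m → 𝟙 (bad-at? m d))
      ≡⟨ ∑-*ˡ x (ι (2 ^ k)) (λ d → ∑ n λ m → 𝟙 (bad-at? m d)) ⟨
    ∑ x (λ d → ι (2 ^ k) ℚ.* ∑ n λ m → 𝟙 (bad-at? m d))
      ≤⟨ ∑-mono x bad-row ⟩
    ∑ x (λ _ → ι n)
      ≡⟨ ∑-const x (ι n) ⟩
    ι x ℚ.* ι n ∎
    where open ℚₚ.≤-Reasoning

  V≤x : V x ≤ℚ ι x
  V≤x = ℚₚ.≤-trans (∑-mono x λ v _ → weight≤1 v) (ℚₚ.≤-reflexive (trans (∑-const x 1ℚ) (ℚₚ.*-identityʳ (ι x))))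
    where
    inv≤1 : ∀ v → inv v ≤ℚ 1ℚ
    inv≤1 zero    = 0≤1
    inv≤1 (suc v) = inv-antimono {0} {suc v} (s≤s z≤n)
    weight≤1 : ∀ v → inert-weight v ≤ℚ 1ℚ
    weight≤1 v with inert? v
    ... | yes _ = ℚₚ.≤-trans (ℚₚ.≤-reflexive (ℚₚ.*-identityˡ (inv v))) (inv≤1 v)
    ... | no _  = ℚₚ.≤-trans (ℚₚ.≤-reflexive (ℚₚ.*-zeroˡ (inv v))) 0≤1

  -- Multiplied by `V x`, the good residues count at most `n` by disjointness. The bad ones number
  -- at most x n / 2 ^ k ≤ n / x, so against the crude bound V(x) ≤ x they also count at most `n`.
  cardS-bound : .{{NonZero x}} → x * x ≤ 2 ^ k → ∀ K → ι K ≤ℚ V x → cardS n * K ≤ 2 * n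
  cardS-bound x²≤2^k K K≤V = ι-cancel-≤ (begin
    ι (cardS n * K)
      ≡⟨ ι-* (cardS n) K ⟩
    ι (cardS n) ℚ.* ι K
      ≤⟨ *-mono (+-nonneg good-count-nonneg bad-count-nonneg) (ι-nonneg K) cardS≤good+bad K≤V ⟩
    (good-count ℚ.+ bad-count) ℚ.* V x
      ≡⟨ solve 3 (λ g b v → (g :+ b) :* v := v :* g :+ b :* v) refl good-count bad-count (V x) ⟩
    V x ℚ.* good-count ℚ.+ bad-count ℚ.* V x
      ≤⟨ ℚₚ.+-mono-≤ V*good≤n (ℚₚ.≤-trans (*-monoˡ bad-count-nonneg V≤x) bad*x≤n) ⟩
    ι n ℚ.+ ι n
      ≡⟨ trans (cong (λ y → ι (n + y)) (ℕₚ.+-identityʳ n)) (ι-+ n n) ⟨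
    ι (2 * n) ∎)
    where
    open ℚₚ.≤-Reasoning
    bad*x≤n : bad-count ℚ.* ι x ≤ℚ ι n
    bad*x≤n = ι-*-cancel x (begin
      ι x ℚ.* (bad-count ℚ.* ι x) ≡⟨ solve 2 (λ a b → a :* (b :* a) := a :* a :* b) refl (ι x) bad-count ⟩
      ι x ℚ.* ι x ℚ.* bad-count   ≡⟨ cong (ℚ._* bad-count) (ι-* x x) ⟨
      ι (x * x) ℚ.* bad-count     ≤⟨ *-monoʳ bad-count-nonneg (ι-mono x²≤2^k) ⟩
      ι (2 ^ k) ℚ.* bad-count     ≤⟨ bad-bound ⟩
      ι x ℚ.* ι n                 ∎)

n<2^n : ∀ n → n < 2 ^ n
n<2^n zero    = s≤s z≤n
n<2^n (suc n) = ℕₚ.≤-trans (ℕₚ.+-mono-≤ (ℕₚ.m^n>0 2 n) (n<2^n n)) (ℕₚ.≤-reflexive (cong (2 ^ n +_) (sym (ℕₚ.+-identityʳ (2 ^ n)))))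

cardS-small : ∀ b N → ∃[ j ] (N ≤ j × cardS (suc j) * b < suc j)
cardS-small b N with V-unbounded (4 * b)
... | x₀ , big = shift n N<n small
  where
  -- The 2 makes x ! even, so that 2 ^ k ≤ n. The exponent serves both demands: the summand `N`
  -- gives N < n, and the summand x² gives x² ≤ 2 ^ k. The factor 4 in K = 4b turns the bound 2n
  -- into 2 b |S| ≤ n, which leaves a strict inequality after halving.
  x = 2 + x₀
  k = N + x * x
  open Density x k
  shift : ∀ n .{{_ : NonZero n}} → N < n → cardS n * b < n → ∃[ j ] (N ≤ j × cardS (suc j) * b < suc j)
  shift (suc j) (s≤s N≤j) p = j , N≤j , p
  2^k≤n : 2 ^ k ≤ n
  2^k≤n = ℕₚ.^-monoˡ-≤ k (∣⇒≤ (∣! {2} {x} (s≤s (s≤s z≤n))))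
  N<n : N < n
  N<n = ℕₚ.≤-trans (ℕₚ.≤-<-trans (ℕₚ.m≤m+n N (x * x)) (n<2^n k)) 2^k≤n
  bound : cardS n * (4 * b) ≤ 2 * n
  bound = cardS-bound (ℕₚ.<⇒≤ (ℕₚ.≤-<-trans (ℕₚ.m≤n+m (x * x) N) (n<2^n k))) (4 * b)
    (ℚₚ.≤-trans big (∑-extend {x₀} {x} (ℕₚ.m≤n+m x₀ 2) inert-weight-nonneg))
  half : ∀ c b → 2 * (2 * (c * b)) ≡ c * (4 * b)
  half = solve-∀
  small : cardS n * b < n
  small = ℕₚ.*-cancelˡ-< 2 _ _ (begin-strict
    2 * (cardS n * b) ≤⟨ ℕₚ.*-cancelˡ-≤ 2 (ℕₚ.≤-trans (ℕₚ.≤-reflexive (half (cardS n) b)) bound) ⟩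
    n                 <⟨ ℕₚ.m<m+n n (ℕₚ.≤-trans (s≤s z≤n) N<n) ⟩
    n + n             ≡⟨ cong (n +_) (ℕₚ.+-identityʳ n) ⟨
    2 * n             ∎)
    where open ℕₚ.≤-Reasoning

-- Moduli for which every residue is a sum of two squares

-- Modulo n = a² + 1 = 2 + e, with 2h ≡ 1, this is (u + v)² h² - (u - v)² h² = u v for u = m, v = 1;
-- m + suc e stands for m - 1, so that no subtraction is needed.
two-squares : ∀ m e h a → a * a ≡ suc e → 2 * h ≡ 3 + e →
  (suc m * h) * (suc m * h) + ((m + suc e) * a * h) * ((m + suc e) * a * h)
    ≡ m + (h * h * ((m + e) * (m + e) + suc e) + (4 + e) * m) * (2 + e)
two-squares m e h a a²≡ 2h≡ = begin
  (suc m * h) * (suc m * h) + ((m + suc e) * a * h) * ((m + suc e) * a * h)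
    ≡⟨ isolate-a² m e h a ⟩
  h * h * (suc m * suc m + a * a * ((m + suc e) * (m + suc e)))
    ≡⟨ cong (λ A → h * h * (suc m * suc m + A * ((m + suc e) * (m + suc e)))) a²≡ ⟩
  h * h * (suc m * suc m + suc e * ((m + suc e) * (m + suc e)))
    ≡⟨ isolate-2h m e h ⟩
  (2 * h) * (2 * h) * m + h * h * ((m + e) * (m + e) + suc e) * (2 + e)
    ≡⟨ cong (λ k → k * k * m + h * h * ((m + e) * (m + e) + suc e) * (2 + e)) 2h≡ ⟩
  (3 + e) * (3 + e) * m + h * h * ((m + e) * (m + e) + suc e) * (2 + e)
    ≡⟨ reduce m e (h * h * ((m + e) * (m + e) + suc e)) ⟩
  m + (h * h * ((m + e) * (m + e) + suc e) + (4 + e) * m) * (2 + e) ∎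
  where
  open ≡-Reasoning
  isolate-a² : ∀ m e h a → (suc m * h) * (suc m * h) + ((m + suc e) * a * h) * ((m + suc e) * a * h)
    ≡ h * h * (suc m * suc m + a * a * ((m + suc e) * (m + suc e)))
  isolate-a² = solve-∀
  isolate-2h : ∀ m e h → h * h * (suc m * suc m + suc e * ((m + suc e) * (m + suc e)))
    ≡ (2 * h) * (2 * h) * m + h * h * ((m + e) * (m + e) + suc e) * (2 + e)
  isolate-2h = solve-∀
  reduce : ∀ m e t → (3 + e) * (3 + e) * m + t * (2 + e) ≡ m + (t + (4 + e) * m) * (2 + e)
  reduce = solve-∀

all-InS : ∀ e h a → a * a ≡ suc e → 2 * h ≡ 3 + e → ∀ m → InS (2 + e) m
all-InS e h a a²≡ 2h≡ m = X mod n , Y mod n , (begin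
  (toℕ (X mod n) * toℕ (X mod n) + toℕ (Y mod n) * toℕ (Y mod n)) % n
    ≡⟨ cong₂ (λ x y → (x * x + y * y) % n) (toℕ-mod X n) (toℕ-mod Y n) ⟩
  (X % n * (X % n) + Y % n * (Y % n)) % n
    ≡⟨ %-distribˡ-+ (X % n * (X % n)) (Y % n * (Y % n)) n ⟩
  ((X % n * (X % n)) % n + (Y % n * (Y % n)) % n) % n
    ≡⟨ cong₂ (λ x y → (x + y) % n) (%-distribˡ-* X X n) (%-distribˡ-* Y Y n) ⟨
  ((X * X) % n + (Y * Y) % n) % n
    ≡⟨ %-distribˡ-+ (X * X) (Y * Y) n ⟨
  (X * X + Y * Y) % n
    ≡⟨ cong (_% n) (two-squares (toℕ m) e h a a²≡ 2h≡) ⟩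
  (toℕ m + q * n) % n
    ≡⟨ [m+kn]%n≡m%n (toℕ m) q n ⟩
  toℕ m % n
    ≡⟨ m<n⇒m%n≡m (toℕ<n m) ⟩
  toℕ m ∎)
  where
  open ≡-Reasoning
  n = 2 + e
  X = suc (toℕ m) * h
  Y = (toℕ m + suc e) * a * h
  q = h * h * ((toℕ m + e) * (toℕ m + e) + suc e) + (4 + e) * toℕ m

cardN-zero : ∀ N → ∃[ j ] (N ≤ j × cardN (suc j) ≡ 0)
cardN-zero N = suc e , N≤j , cong length (filter-none (λ m → ¬? (InS? (2 + e) m))
    (All.universal (λ m ¬s → ¬s (all-InS e h a (a² N) (2h N) m)) (allFin (2 + e))))
  where
  -- With a = 2(N+1) this is a² - 1, so the modulus a² + 1 is 2 + e = `suc (suc e)`, at index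
  -- `suc e`. The inverse of 2 is `h` = (n+1)/2, an integer because `a` is even.
  e = 4 * (N * N) + 8 * N + 3
  a = 2 * suc N
  h = 2 * (suc N * suc N) + 1
  a² : ∀ N → (2 * suc N) * (2 * suc N) ≡ suc (4 * (N * N) + 8 * N + 3)
  a² = solve-∀
  2h : ∀ N → 2 * (2 * (suc N * suc N) + 1) ≡ 3 + (4 * (N * N) + 8 * N + 3)
  2h = solve-∀
  N≤j : N ≤ suc e
  N≤j = begin
    N                              ≤⟨ ℕₚ.m≤n*m N 8 ⟩
    8 * N                          ≤⟨ ℕₚ.m≤n+m (8 * N) (4 * (N * N)) ⟩
    4 * (N * N) + 8 * N            ≤⟨ ℕₚ.m≤m+n _ 3 ⟩
    e                              ≤⟨ ℕₚ.n≤1+n e ⟩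
    suc e                          ∎
    where open ℕₚ.≤-Reasoning

-- From counts to limits inferior and superior

length-partition : ∀ {A : Set} {P : A → Set} (P? : ∀ a → Dec (P a)) xs →
  length (filter P? xs) + length (filter (λ a → ¬? (P? a)) xs) ≡ length xs
length-partition P? []       = refl
length-partition P? (x ∷ xs) with P? x
... | yes _ = cong suc (length-partition P? xs)
... | no _  = trans (ℕₚ.+-suc _ _) (cong suc (length-partition P? xs))

cardS+cardN : ∀ n .{{_ : NonZero n}} → cardS n + cardN n ≡ n
cardS+cardN n = trans (length-partition (InS? n) (allFin n)) (length-tabulate {n = n} (λ i → i))

fractions-sum : ∀ c d k → c + d ≡ suc k → mkℚᵘ (ℤ.+ c) k ℚᵘ.+ mkℚᵘ (ℤ.+ d) k ℚᵘ.≃ 1ℚᵘ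
fractions-sum c d k e = *≡* (begin
  (ℤ.+ c ℤ.* ℤ.+ n ℤ.+ ℤ.+ d ℤ.* ℤ.+ n) ℤ.* ℤ.+ 1  ≡⟨ ℤₚ.*-identityʳ _ ⟩
  ℤ.+ c ℤ.* ℤ.+ n ℤ.+ ℤ.+ d ℤ.* ℤ.+ n            ≡⟨ ℤₚ.*-distribʳ-+ (ℤ.+ n) (ℤ.+ c) (ℤ.+ d) ⟨
  ℤ.+ (c + d) ℤ.* ℤ.+ n                      ≡⟨ cong (λ x → ℤ.+ x ℤ.* ℤ.+ n) e ⟩
  ℤ.+ n ℤ.* ℤ.+ n                            ≡⟨ ℤₚ.*-identityˡ (ℤ.+ n ℤ.* ℤ.+ n) ⟨
  ℤ.+ 1 ℤ.* (ℤ.+ n ℤ.* ℤ.+ n)                  ∎)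
  where
  open ≡-Reasoning
  n = suc k

-- `b` is the denominator of `ε`: c b < n means c/n < 1/b, and 1/b ≤ `ε` because the numerator of
-- `ε` is at least 1.
small-fraction : ∀ ε → 0ℚᵘ ℚᵘ.< ε → ∃[ b ] (∀ c k → c * b < suc k → mkℚᵘ (ℤ.+ c) k ℚᵘ.< ε)
small-fraction (mkℚᵘ (ℤ.+ zero) q)     (*<* (ℤ.+<+ ()))
small-fraction (mkℚᵘ (ℤ.+ suc p) q)    _ = suc q , λ c k c*b<n → *<* (subst (ℤ._< ℤ.+ suc p ℤ.* ℤ.+ suc k) (ℤₚ.pos-* c (suc q))
  (ℤ.+<+ (ℕₚ.<-≤-trans c*b<n (ℕₚ.m≤n*m (suc k) (suc p)))))
small-fraction (mkℚᵘ (ℤ.-[1+ _ ]) q) (*<* ())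

above : ∀ a b L ε → a ℚᵘ.+ b ℚᵘ.≃ L → a ℚᵘ.< ε → L ℚᵘ.- ε ℚᵘ.< b
above a b L ε a+b≃L a<ε = ℚᵘₚ.<-respˡ-≃ left (ℚᵘₚ.<-respʳ-≃ right (ℚᵘₚ.+-monoˡ-< (b ℚᵘ.- ε) a<ε))
  where
  left : a ℚᵘ.+ (b ℚᵘ.- ε) ℚᵘ.≃ L ℚᵘ.- ε
  left = ℚᵘₚ.≃-trans (ℚᵘₚ.≃-sym (ℚᵘₚ.+-assoc a b (ℚᵘ.- ε))) (ℚᵘₚ.+-congˡ (ℚᵘ.- ε) a+b≃L)
  right : ε ℚᵘ.+ (b ℚᵘ.- ε) ℚᵘ.≃ b
  right = ℚᵘ-Solver.solve 2 (λ e b → e ⊕ (b ⊕ ⊝ e) ⊜ b) ℚᵘₚ.≃-refl ε b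

below : ∀ a b L ε → a ℚᵘ.+ b ℚᵘ.≃ L → ℚᵘ.- b ℚᵘ.< ε → a ℚᵘ.< L ℚᵘ.+ ε
below a b L ε a+b≃L -b<ε = ℚᵘₚ.<-respˡ-≃ left (ℚᵘₚ.+-monoʳ-< L -b<ε)
  where
  left : L ℚᵘ.+ ℚᵘ.- b ℚᵘ.≃ a
  left = ℚᵘₚ.≃-trans (ℚᵘₚ.+-congˡ (ℚᵘ.- b) (ℚᵘₚ.≃-sym a+b≃L))
    (ℚᵘ-Solver.solve 2 (λ a b → a ⊕ b ⊕ ⊝ b ⊜ a) ℚᵘₚ.≃-refl a b)

neg-fraction< : ∀ c k ε → 0ℚᵘ ℚᵘ.< ε → ℚᵘ.- mkℚᵘ (ℤ.+ c) k ℚᵘ.< ε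
neg-fraction< c k ε = ℚᵘₚ.≤-<-trans (ℚᵘₚ.neg-mono-≤ (ℚᵘₚ.nonNegative⁻¹ (mkℚᵘ (ℤ.+ c) k)))

-- If f/n comes arbitrarily close to 0 infinitely often, then g/n = 1 - f/n comes arbitrarily close
-- to 1 at the same indices. The other halves of both limits hold from index 0 on, since f/n ≥ 0.
-- Used with the two counts in either order, each instance gives the lower limit of one density and
-- the upper limit of the other.
module Complementary (f g : ℕ → ℕ) (f+g : ∀ k → f k + g k ≡ suc k)
                     (f-small : ∀ b N → ∃[ k ] (N ≤ k × f k * b < suc k)) where

  r : (ℕ → ℕ) → ℕ → ℚᵘ
  r h k = mkℚᵘ (ℤ.+ h k) k

  liminf : IsLiminf (r f) 0ℚᵘ
  liminf ε 0<ε = (0 , λ k _ → above (ℚᵘ.- r f k) (r f k) 0ℚᵘ ε (ℚᵘₚ.+-inverseˡ (r f k)) (neg-fraction< (f k) k ε 0<ε)) , λ N → close N (f-small (proj₁ small) N)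
    where
    small = small-fraction ε 0<ε
    close : ∀ N → ∃[ k ] (N ≤ k × f k * proj₁ small < suc k) → ∃[ k ] (N ≤ k × r f k ℚᵘ.< 0ℚᵘ ℚᵘ.+ ε)
    close N (k , N≤k , p) = k , N≤k , ℚᵘₚ.<-respʳ-≃ (ℚᵘₚ.≃-sym (ℚᵘₚ.+-identityˡ ε)) (proj₂ small (f k) k p)

  limsup : IsLimsup (r g) 1ℚᵘ
  limsup ε 0<ε = (0 , λ k _ → below (r g k) (r f k) 1ℚᵘ ε (fractions-sum (g k) (f k) k (trans (ℕₚ.+-comm (g k) (f k)) (f+g k))) (neg-fraction< (f k) k ε 0<ε)) ,
      λ N → close N (f-small (proj₁ small) N)
    where
    small = small-fraction ε 0<ε
    close : ∀ N → ∃[ k ] (N ≤ k × f k * proj₁ small < suc k) → ∃[ k ] (N ≤ k × 1ℚᵘ ℚᵘ.- ε ℚᵘ.< r g k)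
    close N (k , N≤k , p) = k , N≤k , above (r f k) (r g k) 1ℚᵘ ε (fractions-sum (f k) (g k) k (f+g k)) (proj₂ small (f k) k p)

theorem5 : (IsLiminf rS 0ℚᵘ × IsLiminf rN 0ℚᵘ) × (IsLimsup rS 1ℚᵘ × IsLimsup rN 1ℚᵘ)
theorem5 = (S.liminf , N.liminf) , (N.limsup , S.limsup)
  where
  cardN-small : ∀ b N → ∃[ k ] (N ≤ k × cardN (suc k) * b < suc k)
  cardN-small b N = let k , N≤k , e = cardN-zero N in
    k , N≤k , ℕₚ.≤-<-trans (ℕₚ.≤-reflexive (cong (_* b) e)) (s≤s z≤n)
  module S = Complementary (λ k → cardS (suc k)) (λ k → cardN (suc k)) (λ k → cardS+cardN (suc k)) cardS-small
  module N = Complementary (λ k → cardN (suc k)) (λ k → cardS (suc k))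
    (λ k → trans (ℕₚ.+-comm (cardN (suc k)) (cardS (suc k))) (cardS+cardN (suc k))) cardN-small
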